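{- Let $r,s$ be coprime positive integers with $2\nmid s$ and $1\le s<r/2$. Let $\Delta_2=s(r-s)(2r-s)$ and define $p_{3,r-s}(n)$ by $$\sum_{n=0}^\infty p_{3,r-s}(n)q^n=\frac{1}{(1-q^s)(1-q^{r-s})(1-q^{2r-s})}.$$ Then for all integers $n\ge 0$, $$P_{2,r-s}(n)+C^{d}_{3,r-s}\ \le\ p_{3,r-s}(n)\ \le\ P_{2,r-s}(n)+C^{u}_{3,r-s},$$ where $$\begin{aligned} P_{2,r-s}(n)&=\frac{1}{2\Delta_2}\left(-1+n^2+3r+n(3r-s)-s\right),\\ C^{u}_{3,r-s}&=\frac{1}{2\Delta_2}\Big(r^3(4s^2-2s)+r^2(-10s^3+3s^2+4s)+r(8s^4-s^3-6s^2-2s-2)\\ &\qquad\quad-2s^5+2s^3+2s^2+s+1\Big),\\ C^{d}_{3,r-s}&=\frac{1}{2\Delta_2}\Big(r^3(-4s^2-2s)+r^2(10s^3+3s^2)+r(-8s^4-s^3+2s-2)+2s^5-2s^2+s+1\Big). \end{aligned}$$ -}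

module Defs where

open import Data.Bool.Base using (if_then_else_)
open import Data.Fin.Base using (toℕ)
open import Data.Integer.Base using (ℤ; +_; -_; _+_; _-_; _*_; _^_; 0ℤ; 1ℤ)
open import Data.Integer.Properties using (+-0-monoid)
open import Data.Nat.Base as ℕ using (ℕ; NonZero; _∸_; _≡ᵇ_; _≤_; _<_)
import Data.Nat.Properties as ℕₚ
open import Data.Rational.Base using (ℚ; _/_)
open import Relation.Binary.PropositionalEquality using (_≗_)
open import Algebra.Properties.Monoid.Sum +-0-monoid using (sum⁺-syntax)

infixl 7 _⊛_
infix 8 q^_ 1-q^_

-- ℤ[[q]]: the series f stands for Σₙ f(n) qⁿ.
Series : Set
Series = ℕ → ℤ

q^_ : ℕ → Series
(q^ a) n = if n ≡ᵇ a then 1ℤ else 0ℤ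

𝟙 : Series
𝟙 = q^ 0

1-q^_ : ℕ → Series
(1-q^ a) n = 𝟙 n - (q^ a) n

_⊛_ : Series → Series → Series
(f ⊛ g) n = ∑[ i ≤ n ] (f (toℕ i) * g (n ∸ toℕ i))

_IsReciprocalOf_ : Series → Series → Set
f IsReciprocalOf g = f ⊛ g ≗ 𝟙

-- Everywhere below s < r, so the truncated subtractions r ∸ s and 2 r ∸ s
-- are the true differences.
denominator : ℕ → ℕ → Series
denominator r s = 1-q^ s ⊛ 1-q^ (r ∸ s) ⊛ 1-q^ (2 ℕ.* r ∸ s)

Δ₂ : ℕ → ℕ → ℕ
Δ₂ r s = s ℕ.* (r ∸ s) ℕ.* (2 ℕ.* r ∸ s)

2Δ₂-nonZero : ∀ {r s} → 1 ≤ s → 2 ℕ.* s < r → NonZero (2 ℕ.* Δ₂ r s)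
2Δ₂-nonZero {r} {s} 1≤s 2s<r =
  ℕₚ.m*n≢0 2 (Δ₂ r s) {{_}} {{ℕₚ.m*n≢0 (s ℕ.* (r ∸ s)) (2 ℕ.* r ∸ s)
    {{ℕₚ.m*n≢0 s (r ∸ s) {{ℕ.>-nonZero 1≤s}} {{pos s<r}}}}
    {{pos (ℕₚ.<-≤-trans s<r (ℕₚ.m≤n*m r 2))}}}}
  where
  s<r : s < r
  s<r = ℕₚ.≤-<-trans (ℕₚ.m≤n*m s 2) 2s<r

  pos : ∀ {m n} → m < n → NonZero (n ∸ m)
  pos m<n = ℕ.>-nonZero (ℕₚ.m<n⇒0<n∸m m<n)

module _ (r s : ℕ) .{{_ : NonZero (2 ℕ.* Δ₂ r s)}} where

  private
    R S : ℤ
    R = + r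
    S = + s

  P₂ : ℕ → ℚ
  P₂ n =
    (- 1ℤ + N ^ 2 + + 3 * R + N * (+ 3 * R - S) - S) / (2 ℕ.* Δ₂ r s)
    where
    N : ℤ
    N = + n

  C₃ᵘ : ℚ
  C₃ᵘ =
    ( R ^ 3 * (+ 4 * S ^ 2 - + 2 * S)
    + R ^ 2 * (- (+ 10) * S ^ 3 + + 3 * S ^ 2 + + 4 * S)
    + R * (+ 8 * S ^ 4 - S ^ 3 - + 6 * S ^ 2 - + 2 * S - + 2)
    - + 2 * S ^ 5 + + 2 * S ^ 3 + + 2 * S ^ 2 + S + 1ℤ
    ) / (2 ℕ.* Δ₂ r s)

  C₃ᵈ : ℚ
  C₃ᵈ =
    ( R ^ 3 * (- (+ 4) * S ^ 2 - + 2 * S)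
    + R ^ 2 * (+ 10 * S ^ 3 + + 3 * S ^ 2)
    + R * (- (+ 8) * S ^ 4 - S ^ 3 + + 2 * S - + 2)
    + + 2 * S ^ 5 - + 2 * S ^ 2 + S + 1ℤ
    ) / (2 ℕ.* Δ₂ r s)

{-# OPTIONS --safe #-}

-- Write a = s, b = r − s, c = 2r − s; these are pairwise coprime and c = a + 2b. Extend p by 0
-- to negative arguments and put p₂(m) = p(m) − p(m − c), the number of representations of m
-- by a and b. Popoviciu's formula gives, for m ≥ 0,
--   2ab p₂(m) = 2m + a + b − b·A(m) − a·B(m),
-- where A is a-periodic, odd under m ↦ −b − m and bounded by a − 1 (and B likewise with a and
-- b exchanged). Summing over m = w + cz for z ≤ Z, with n = w + cZ and 0 ≤ w < c, the linear
-- terms give n² + n(a + b + c) + (c − w)(w + a + b) after multiplication by c. The sum of A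
-- over a consecutive values of z vanishes because c is invertible modulo a and A is odd, so its
-- partial sums are at most (a − 1)² in absolute value; similarly for B. The stated constants
-- leave enough room for these crude bounds.
module Submission where

open import Defs
open import Algebra.Properties.Monoid.Sum using (sum)
open import Data.Fin.Base using (toℕ)
import Data.Integer.Base as ℤᵇ
open import Data.Integer.Base using (ℤ; +_; -[1+_]; +[1+_]; -_; 0ℤ; 1ℤ; ∣_∣; _%ℕ_; _/ℕ_)
import Data.Integer.DivMod as ℤᵈ
import Data.Integer.Properties as ℤₚ
open import Algebra.Properties.AbelianGroup ℤₚ.+-0-abelianGroup using (∙-cancelˡ)
open import Data.Integer.Tactic.RingSolver using (solve-∀)
import Data.Nat.Base as ℕᵇ
open import Data.Nat.Base using (ℕ; NonZero; zero; suc; _∸_; z≤n; s≤s) renaming (_≤_ to _≤ⁿ_; _<_ to _<ⁿ_)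
import Data.Nat.Coprimality as Coprimality
open import Data.Nat.Coprimality using (Coprime)
import Data.Nat.Divisibility as Div
open import Data.Nat.Divisibility using (_∤_)
import Data.Nat.DivMod as ℕᵈ
open import Data.Nat.GCD using (module Bézout)
open import Data.Nat.Induction using (<-rec)
import Data.Nat.Properties as ℕₚ
open import Data.Product.Base using (_×_; ∃₂; Σ-syntax; _,_; proj₁; proj₂)
import Data.Rational.Base as ℚ
import Data.Rational.Properties as ℚₚ
import Data.Rational.Unnormalised.Base as ℚᵘ
import Data.Rational.Unnormalised.Properties as ℚᵘₚ
open import Data.Sum.Base using (inj₁; inj₂)
open import Function.Base using (_∘_)
open import Relation.Binary.PropositionalEquality using (_≡_; _≗_; refl; sym; trans; cong; cong₂; subst; subst₂; module ≡-Reasoning)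
open import Relation.Nullary using (contradiction)

module _ where
  open ℤᵇ using (_+_; _-_; _*_; _^_; _≤_; _<_)
  open ≡-Reasoning

  -- Finite sums of integers.

  Σ< : (ℕ → ℤ) → ℕ → ℤ
  Σ< F zero    = 0ℤ
  Σ< F (suc n) = Σ< F n + F n

  Σ<-cong-< : ∀ {F G} n → (∀ i → i <ⁿ n → F i ≡ G i) → Σ< F n ≡ Σ< G n
  Σ<-cong-< zero    eq = refl
  Σ<-cong-< (suc n) eq =
    cong₂ _+_ (Σ<-cong-< n λ i i<n → eq i (ℕₚ.m<n⇒m<1+n i<n)) (eq n (ℕₚ.n<1+n n))

  Σ<-cong : ∀ {F G} n → F ≗ G → Σ< F n ≡ Σ< G n
  Σ<-cong n eq = Σ<-cong-< n λ i _ → eq i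

  Σ<-zero : ∀ {F} n → (∀ i → i <ⁿ n → F i ≡ 0ℤ) → Σ< F n ≡ 0ℤ
  Σ<-zero zero    eq = refl
  Σ<-zero (suc n) eq =
    cong₂ _+_ (Σ<-zero n λ i i<n → eq i (ℕₚ.m<n⇒m<1+n i<n)) (eq n (ℕₚ.n<1+n n))

  Σ<-neg : ∀ F n → Σ< (-_ ∘ F) n ≡ - Σ< F n
  Σ<-neg F zero    = refl
  Σ<-neg F (suc n) = begin
    Σ< (-_ ∘ F) n + - F n ≡⟨ cong (_+ - F n) (Σ<-neg F n) ⟩
    - Σ< F n + - F n      ≡⟨ ℤₚ.neg-distrib-+ (Σ< F n) (F n) ⟨
    - (Σ< F n + F n)      ∎

  Σ<-sub : ∀ F G n → Σ< (λ i → F i - G i) n ≡ Σ< F n - Σ< G n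
  Σ<-sub F G zero    = refl
  Σ<-sub F G (suc n) = begin
    Σ< (λ i → F i - G i) n + (F n - G n)  ≡⟨ cong (_+ (F n - G n)) (Σ<-sub F G n) ⟩
    Σ< F n - Σ< G n + (F n - G n)         ≡⟨ interchange (Σ< F n) (Σ< G n) (F n) (G n) ⟩
    Σ< F n + F n - (Σ< G n + G n)         ∎
    where
    interchange : ∀ x y z w → x - y + (z - w) ≡ x + z - (y + w)
    interchange = solve-∀

  Σ<-split : ∀ F m n → Σ< F (m ℕᵇ.+ n) ≡ Σ< F m + Σ< (λ i → F (m ℕᵇ.+ i)) n
  Σ<-split F m zero    =
    trans (cong (Σ< F) (ℕₚ.+-identityʳ m)) (sym (ℤₚ.+-identityʳ _))
  Σ<-split F m (suc n) = begin
    Σ< F (m ℕᵇ.+ suc n)                                       ≡⟨ cong (Σ< F) (ℕₚ.+-suc m n) ⟩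
    Σ< F (m ℕᵇ.+ n) + F (m ℕᵇ.+ n)                             ≡⟨ cong (_+ F (m ℕᵇ.+ n)) (Σ<-split F m n) ⟩
    Σ< F m + Σ< (λ i → F (m ℕᵇ.+ i)) n + F (m ℕᵇ.+ n)          ≡⟨ ℤₚ.+-assoc (Σ< F m) _ _ ⟩
    Σ< F m + (Σ< (λ i → F (m ℕᵇ.+ i)) n + F (m ℕᵇ.+ n))        ∎

  Σ<-head : ∀ F n → Σ< F (suc n) ≡ F 0 + Σ< (F ∘ suc) n
  Σ<-head F n = trans (Σ<-split F 1 n) (cong (_+ Σ< (F ∘ suc) n) (ℤₚ.+-identityˡ (F 0)))

  Σ<-reverse : ∀ F n → Σ< F n ≡ Σ< (λ i → F (n ∸ suc i)) n
  Σ<-reverse F zero    = refl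
  Σ<-reverse F (suc n) = begin
    Σ< F n + F n                          ≡⟨ ℤₚ.+-comm (Σ< F n) (F n) ⟩
    F n + Σ< F n                          ≡⟨ cong (_+_ (F n)) (Σ<-reverse F n) ⟩
    F n + Σ< (λ i → F (n ∸ suc i)) n      ≡⟨ Σ<-head (λ i → F (n ∸ i)) n ⟨
    Σ< (λ i → F (n ∸ i)) (suc n)          ∎

  sum≡Σ< : ∀ F n → sum ℤₚ.+-0-monoid {n} (F ∘ toℕ) ≡ Σ< F n
  sum≡Σ< F zero    = refl
  sum≡Σ< F (suc n) = trans (cong (_+_ (F 0)) (sum≡Σ< (F ∘ suc) n)) (sym (Σ<-head F n))

  ∣Σ<∣≤ : ∀ F n {K} → (∀ i → ∣ F i ∣ ≤ⁿ K) → ∣ Σ< F n ∣ ≤ⁿ n ℕᵇ.* K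
  ∣Σ<∣≤ F zero    bound = z≤n
  ∣Σ<∣≤ F (suc n) {K} bound = ℕₚ.≤-trans (ℤₚ.∣i+j∣≤∣i∣+∣j∣ (Σ< F n) (F n))
    (ℕₚ.≤-trans (ℕₚ.+-mono-≤ (∣Σ<∣≤ F n bound) (bound n)) (ℕₚ.≤-reflexive (ℕₚ.+-comm _ K)))

  -- Series on integer exponents and difference operators.

  ext : Series → ℤ → ℤ
  ext f (+ n)    = f n
  ext f -[1+ _ ] = 0ℤ

  -- Multiplication by `1-q^ a` on coefficients. Arguments range over all integers, so that the
  -- shift by `a` never truncates.
  T : ℕ → (ℤ → ℤ) → ℤ → ℤ
  T a F m = F m - F (m - + a)

  T-cong : ∀ a {F G} → F ≗ G → T a F ≗ T a G
  T-cong a eq m = cong₂ _-_ (eq m) (eq (m - + a))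

  T-comm : ∀ a b F → T a (T b F) ≗ T b (T a F)
  T-comm a b F m = begin
    F m - F (m - + b) - (F (m - + a) - F (m - + a - + b))
      ≡⟨ cong (λ x → F m - F (m - + b) - (F (m - + a) - F x)) (swap m (+ a) (+ b)) ⟩
    F m - F (m - + b) - (F (m - + a) - F (m - + b - + a))
      ≡⟨ swap′ (F m) (F (m - + b)) (F (m - + a)) (F (m - + b - + a)) ⟩
    F m - F (m - + a) - (F (m - + b) - F (m - + b - + a)) ∎
    where
    swap : ∀ x y z → x - y - z ≡ x - z - y
    swap = solve-∀
    swap′ : ∀ x y z w → x - y - (z - w) ≡ x - z - (y - w)
    swap′ = solve-∀

  ext-cong : ∀ {f g} → f ≗ g → ext f ≗ ext g
  ext-cong eq (+ n)    = eq n
  ext-cong eq -[1+ _ ] = refl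

  ext-neg : ∀ f {m} → m < 0ℤ → ext f m ≡ 0ℤ
  ext-neg f {+ _}      (ℤᵇ.+<+ ())
  ext-neg f { -[1+ _ ]} _ = refl

  ext-∸ : ∀ f {n i} → i ≤ⁿ n → ext f (+ n - + i) ≡ f (n ∸ i)
  ext-∸ f {n} {i} i≤n = cong (ext f) (trans (ℤₚ.m-n≡m⊖n n i) (ℤₚ.⊖-≥ i≤n))

  ⊛≡Σ< : ∀ f g n → (f ⊛ g) n ≡ Σ< (λ i → f i * ext g (+ n - + i)) (suc n)
  ⊛≡Σ< f g n = trans (sum≡Σ< (λ i → f i * g (n ∸ i)) (suc n))
    (Σ<-cong-< (suc n) λ i i≤n → cong (_*_ (f i)) (sym (ext-∸ g (ℕₚ.≤-pred i≤n))))

  sub-neg : ∀ {m} i → m < + i → m - + i < 0ℤ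
  sub-neg {m} i m<i = subst (m - + i <_) (ℤₚ.+-inverseʳ (+ i)) (ℤₚ.+-monoˡ-< (- + i) m<i)

  term-zero : ∀ (f g : Series) m i → m < + i → f i * ext g (m - + i) ≡ 0ℤ
  term-zero f g m i m<i =
    trans (cong (_*_ (f i)) (ext-neg g (sub-neg i m<i))) (ℤₚ.*-zeroʳ (f i))

  -- Terms with `i > m` evaluate `g` at a negative exponent and vanish, so the length `k` is free.
  -- Convolutions at `m` and at `m - + a` can thus be written as sums of equal length.
  ext-⊛ : ∀ f g m k → m < + k → ext (f ⊛ g) m ≡ Σ< (λ i → f i * ext g (m - + i)) k
  ext-⊛ f g -[1+ n ] k _ =
    sym (Σ<-zero k λ i _ → term-zero f g -[1+ n ] i ℤᵇ.-<+)
  ext-⊛ f g (+ n) k (ℤᵇ.+<+ n<k) = begin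
    (f ⊛ g) n
      ≡⟨ ⊛≡Σ< f g n ⟩
    Σ< F (suc n)
      ≡⟨ ℤₚ.+-identityʳ _ ⟨
    Σ< F (suc n) + 0ℤ
      ≡⟨ cong (λ x → Σ< F (suc n) + x) (Σ<-zero (k ∸ suc n) λ i _ →
           term-zero f g (+ n) (suc n ℕᵇ.+ i) (ℤᵇ.+<+ (s≤s (ℕₚ.m≤m+n n i)))) ⟨
    Σ< F (suc n) + Σ< (λ i → F (suc n ℕᵇ.+ i)) (k ∸ suc n)
      ≡⟨ Σ<-split F (suc n) (k ∸ suc n) ⟨
    Σ< F (suc n ℕᵇ.+ (k ∸ suc n))
      ≡⟨ cong (Σ< F) (ℕₚ.m+[n∸m]≡n n<k) ⟩
    Σ< F k ∎
    where
    F : ℕ → ℤ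
    F i = f i * ext g (+ n - + i)

  ext-⊛-T : ∀ a f g h → ext h ≗ T a (ext g) → ext (f ⊛ h) ≗ T a (ext (f ⊛ g))
  ext-⊛-T a f g h eq m = begin
    ext (f ⊛ h) m
      ≡⟨ ext-⊛ f h m k m<k ⟩
    Σ< (λ i → f i * ext h (m - + i)) k
      ≡⟨ Σ<-cong k (λ i → trans (cong (_*_ (f i)) (eq (m - + i)))
           (distrib (f i) (ext g (m - + i)) (ext g (m - + i - + a)))) ⟩
    Σ< (λ i → f i * ext g (m - + i) - f i * ext g (m - + i - + a)) k
      ≡⟨ Σ<-sub _ _ k ⟩
    Σ< (λ i → f i * ext g (m - + i)) k - Σ< (λ i → f i * ext g (m - + i - + a)) k
      ≡⟨ cong₂ _-_ (sym (ext-⊛ f g m k m<k)) (Σ<-cong k λ i →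
           cong (λ x → f i * ext g x) (swap m (+ i) (+ a))) ⟩
    ext (f ⊛ g) m - Σ< (λ i → f i * ext g (m - + a - + i)) k
      ≡⟨ cong (λ x → ext (f ⊛ g) m - x) (ext-⊛ f g (m - + a) k m-a<k) ⟨
    ext (f ⊛ g) m - ext (f ⊛ g) (m - + a) ∎
    where
    k : ℕ
    k = suc ∣ m ∣
    i≤∣i∣ : ∀ i → i ≤ + ∣ i ∣
    i≤∣i∣ (+ n)    = ℤₚ.≤-refl
    i≤∣i∣ -[1+ _ ] = ℤᵇ.-≤+
    m<k : m < + k
    m<k = ℤₚ.≤-<-trans (i≤∣i∣ m) (ℤᵇ.+<+ (ℕₚ.n<1+n ∣ m ∣))
    m-a<k : m - + a < + k
    m-a<k = ℤₚ.≤-<-trans (ℤₚ.i-j≤i m (+ a)) m<k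
    distrib : ∀ x y z → x * (y - z) ≡ x * y - x * z
    distrib = solve-∀
    swap : ∀ x y z → x - y - z ≡ x - z - y
    swap = solve-∀

  ⊛-identityʳ : ∀ f → f ⊛ 𝟙 ≗ f
  ⊛-identityʳ f n = begin
    (f ⊛ 𝟙) n                                       ≡⟨ sum≡Σ< F (suc n) ⟩
    Σ< F n + F n                                    ≡⟨ cong₂ _+_ (Σ<-zero n λ i i<n →
      trans (cong (_*_ (f i)) (𝟙-pos (ℕₚ.m<n⇒0<n∸m i<n))) (ℤₚ.*-zeroʳ (f i))) lastTerm ⟩
    0ℤ + f n                                        ≡⟨ ℤₚ.+-identityˡ (f n) ⟩
    f n                                             ∎
    where
    F : ℕ → ℤ
    F i = f i * 𝟙 (n ∸ i)
    𝟙-pos : ∀ {k} → 0 <ⁿ k → 𝟙 k ≡ 0ℤ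
    𝟙-pos (s≤s _) = refl
    lastTerm : F n ≡ f n
    lastTerm = trans (cong (λ k → f n * 𝟙 k) (ℕₚ.n∸n≡0 n)) (ℤₚ.*-identityʳ (f n))

  ext-1-q^ : ∀ a → ext (1-q^ a) ≗ T a (ext 𝟙)
  ext-1-q^ a -[1+ n ] = sym (cong (λ x → 0ℤ - x)
    (ext-neg 𝟙 (ℤₚ.≤-<-trans (ℤₚ.i-j≤i -[1+ n ] (+ a)) (ℤᵇ.-<+ {n} {0}))))
  ext-1-q^ a (+ n) = cong (λ x → 𝟙 n - x)
    (trans (q^≡ n a) (cong (ext 𝟙) (sym (ℤₚ.m-n≡m⊖n n a))))
    where
    q^≡ : ∀ n a → (q^ a) n ≡ ext 𝟙 (n ℤᵇ.⊖ a)
    q^≡ n       zero    = refl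
    q^≡ zero    (suc a) = refl
    q^≡ (suc n) (suc a) = trans (q^≡ n a) (cong (ext 𝟙) (sym (ℤₚ.[1+m]⊖[1+n]≡m⊖n n a)))

  ext-⊛-1-q^ : ∀ a f → ext (f ⊛ 1-q^ a) ≗ T a (ext f)
  ext-⊛-1-q^ a f m = trans (ext-⊛-T a f 𝟙 (1-q^ a) (ext-1-q^ a) m)
    (T-cong a (ext-cong (⊛-identityʳ f)) m)

  -- After `T a` has been commuted innermost, `T a`, `T b`, `T c` are absorbed in turn into the
  -- right factor of `p ⊛ _`, which builds up the denominator in its own bracketing; associativity
  -- of `⊛` is never invoked. The conclusion keeps `T c` innermost because Popoviciu's formula is
  -- applied to `T c (ext p)`.
  reciprocal⇒T : ∀ a b c p → p IsReciprocalOf (1-q^ a ⊛ 1-q^ b ⊛ 1-q^ c) →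
    T b (T a (T c (ext p))) ≗ ext 𝟙
  reciprocal⇒T a b c p recip m = begin
    T b (T a (T c (ext p))) m           ≡⟨ T-cong b (T-comm a c (ext p)) m ⟩
    T b (T c (T a (ext p))) m           ≡⟨ T-comm b c (T a (ext p)) m ⟩
    T c (T b (T a (ext p))) m           ≡⟨ T-cong c (T-cong b (ext-⊛-1-q^ a p)) m ⟨
    T c (T b (ext (p ⊛ A))) m           ≡⟨ T-cong c (ext-⊛-T b p A (A ⊛ B) (ext-⊛-1-q^ b A)) m ⟨
    T c (ext (p ⊛ (A ⊛ B))) m           ≡⟨ ext-⊛-T c p (A ⊛ B) (A ⊛ B ⊛ C) (ext-⊛-1-q^ c (A ⊛ B)) m ⟨
    ext (p ⊛ (A ⊛ B ⊛ C)) m             ≡⟨ ext-cong recip m ⟩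
    ext 𝟙 m                             ∎
    where
    A B C : Series
    A = 1-q^ a
    B = 1-q^ b
    C = 1-q^ c

  -- Remainders and the sawtooth function.

  multiple-small⇒0 : ∀ d k {x} → x ≡ k * + d → - + d < x → x < + d → x ≡ 0ℤ
  multiple-small⇒0 d (+ zero) eq _ _ = eq
  multiple-small⇒0 d +[1+ j ] {x} eq _ x<d = contradiction x<d (ℤₚ.≤⇒≯ d≤x)
    where
    d≤x : + d ≤ x
    d≤x = subst (+ d ≤_) (trans (ℤₚ.pos-* (suc j) d) (sym eq)) (ℤᵇ.+≤+ (ℕₚ.m≤m+n d (j ℕᵇ.* d)))
  multiple-small⇒0 d -[1+ j ] {x} eq -d<x _ = contradiction -d<x (ℤₚ.≤⇒≯ x≤-d)
    where
    x≤-d : x ≤ - + d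
    x≤-d = subst (_≤ - + d)
      (trans (cong -_ (ℤₚ.pos-* (suc j) d)) (trans (ℤₚ.neg-distribˡ-* +[1+ j ] (+ d)) (sym eq)))
      (ℤₚ.neg-mono-≤ (ℤᵇ.+≤+ (ℕₚ.m≤m+n d (j ℕᵇ.* d))))

  pos-diff-< : ∀ {m n} → m <ⁿ n → ∀ k → + m - + k < + n
  pos-diff-< {m} m<n k = ℤₚ.≤-<-trans (ℤₚ.i-j≤i (+ m) (+ k)) (ℤᵇ.+<+ m<n)

  module _ (a : ℕ) .{{_ : NonZero a}} where

    -- Two such remainders differ by a multiple of `a` that lies strictly between `-a` and `a`.
    %ℕ-unique : ∀ x r q → r <ⁿ a → x ≡ + r + q * + a → x %ℕ a ≡ r
    %ℕ-unique x r q r<a eq = ℤₚ.+-injective (ℤₚ.i-j≡0⇒i≡j (+ r′) (+ r)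
      (multiple-small⇒0 a (q - q′) diff -a< (pos-diff-< r′<a r)))
      where
      r′ = x %ℕ a
      q′ = x /ℕ a
      r′<a : r′ <ⁿ a
      r′<a = ℤᵈ.n%ℕd<d x a
      rearrange : ∀ x q q′ a → x - q′ * a - (x - q * a) ≡ (q - q′) * a
      rearrange = solve-∀
      solved : ∀ x r q → x ≡ r + q * + a → r ≡ x - q * + a
      solved x r q eq = trans (cancel r (q * + a)) (cong (_- q * + a) (sym eq))
        where
        cancel : ∀ r y → r ≡ r + y - y
        cancel = solve-∀
      diff : + r′ - + r ≡ (q - q′) * + a
      diff = trans (cong₂ _-_ (solved x (+ r′) q′ (ℤᵈ.a≡a%ℕn+[a/ℕn]*n x a)) (solved x (+ r) q eq))
        (rearrange x q q′ (+ a))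
      -a< : - + a < + r′ - + r
      -a< = subst (- + a <_) (flip (+ r) (+ r′)) (ℤₚ.neg-mono-< (pos-diff-< r<a r′))
        where
        flip : ∀ y z → - (y - z) ≡ z - y
        flip = solve-∀

    %ℕ-periodic : ∀ x k → (x + k * + a) %ℕ a ≡ x %ℕ a
    %ℕ-periodic x k = %ℕ-unique (x + k * + a) (x %ℕ a) (x /ℕ a + k) (ℤᵈ.n%ℕd<d x a)
      (trans (cong (_+ k * + a) (ℤᵈ.a≡a%ℕn+[a/ℕn]*n x a))
        (collect (+ (x %ℕ a)) (x /ℕ a) k (+ a)))
      where
      collect : ∀ r q k a → r + q * a + k * a ≡ r + (q + k) * a
      collect = solve-∀

    -- The additive form lets ring identities treat `a ∸ suc r` as an atom.
    %ℕ-complement : ∀ x → + a ≡ 1ℤ + + (x %ℕ a) + + (a ∸ suc (x %ℕ a))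
    %ℕ-complement x = cong +_ (sym (ℕₚ.m+[n∸m]≡n (ℤᵈ.n%ℕd<d x a)))

    %ℕ-reflect : ∀ x → (- 1ℤ - x) %ℕ a ≡ a ∸ suc (x %ℕ a)
    %ℕ-reflect x = %ℕ-unique (- 1ℤ - x) j (- 1ℤ - q) (ℕₚ.∸-monoʳ-< (ℕᵇ.s≤s z≤n) (ℤᵈ.n%ℕd<d x a)) (begin
      - 1ℤ - x                          ≡⟨ cong (λ y → - 1ℤ - y) (ℤᵈ.a≡a%ℕn+[a/ℕn]*n x a) ⟩
      - 1ℤ - (+ r + q * + a)            ≡⟨ step (+ r) (+ j) q (+ a) ⟩
      -- The ring solver proves an unconditional identity in which the known equation appears as a
      -- difference; that difference is then replaced by 0. Later calculations use the same device.
      + j + (- 1ℤ - q) * + a + (+ a - (1ℤ + + r + + j))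
        ≡⟨ cong (λ y → + j + (- 1ℤ - q) * + a + y) (ℤₚ.i≡j⇒i-j≡0 (%ℕ-complement x)) ⟩
      + j + (- 1ℤ - q) * + a + 0ℤ       ≡⟨ ℤₚ.+-identityʳ _ ⟩
      + j + (- 1ℤ - q) * + a            ∎)
      where
      r = x %ℕ a
      q = x /ℕ a
      j = a ∸ suc r
      step : ∀ r j q a → - 1ℤ - (r + q * a) ≡ j + (- 1ℤ - q) * a + (a - (1ℤ + r + j))
      step = solve-∀

    -- Twice the deviation of b′m mod a from its mean (a − 1)/2.
    saw : ℤ → ℤ → ℤ
    saw b′ m = + 2 * + ((b′ * m) %ℕ a) - (+ a - 1ℤ)

    saw-periodic : ∀ b′ m k → saw b′ (m + k * + a) ≡ saw b′ m
    saw-periodic b′ m k = cong (λ r → + 2 * + r - (+ a - 1ℤ))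
      (trans (cong (_%ℕ a) (expand b′ m k (+ a))) (%ℕ-periodic (b′ * m) (b′ * k)))
      where
      expand : ∀ b m k a → b * (m + k * a) ≡ b * m + b * k * a
      expand = solve-∀

    -- Modulo `a`, `b′ * (- b - m)` is `-1 - b′ * m`, so the remainder `r` turns into `a - 1 - r`,
    -- its mirror image in the mean `(a - 1)/2`.
    saw-reflect : ∀ b b′ k → b * b′ ≡ 1ℤ + k * + a → ∀ m → saw b′ (- b - m) ≡ - saw b′ m
    saw-reflect b b′ k inv m = begin
      + 2 * + ((b′ * (- b - m)) %ℕ a) - (+ a - 1ℤ)
        ≡⟨ cong (λ r → + 2 * + r - (+ a - 1ℤ)) residue ⟩
      + 2 * + j - (+ a - 1ℤ)
        ≡⟨ negate (+ r) (+ j) (+ a) ⟩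
      - (+ 2 * + r - (+ a - 1ℤ)) - + 2 * (+ a - (1ℤ + + r + + j))
        ≡⟨ cong (λ y → - (+ 2 * + r - (+ a - 1ℤ)) - + 2 * y)
             (ℤₚ.i≡j⇒i-j≡0 (%ℕ-complement (b′ * m))) ⟩
      - (+ 2 * + r - (+ a - 1ℤ)) - 0ℤ
        ≡⟨ ℤₚ.+-identityʳ _ ⟩
      - (+ 2 * + r - (+ a - 1ℤ)) ∎
      where
      r = (b′ * m) %ℕ a
      j = a ∸ suc r
      expand : ∀ b b′ m → b′ * (- b - m) ≡ - (b * b′) - b′ * m
      expand = solve-∀
      regroup : ∀ k a x → - (1ℤ + k * a) - x ≡ - 1ℤ - x + - k * a
      regroup = solve-∀
      negate : ∀ r j a → + 2 * j - (a - 1ℤ) ≡ - (+ 2 * r - (a - 1ℤ)) - + 2 * (a - (1ℤ + r + j))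
      negate = solve-∀
      residue : (b′ * (- b - m)) %ℕ a ≡ j
      residue = begin
        (b′ * (- b - m)) %ℕ a                   ≡⟨ cong (_%ℕ a) (expand b b′ m) ⟩
        (- (b * b′) - b′ * m) %ℕ a              ≡⟨ cong (λ y → (- y - b′ * m) %ℕ a) inv ⟩
        (- (1ℤ + k * + a) - b′ * m) %ℕ a        ≡⟨ cong (_%ℕ a) (regroup k (+ a) (b′ * m)) ⟩
        (- 1ℤ - b′ * m + - k * + a) %ℕ a        ≡⟨ %ℕ-periodic (- 1ℤ - b′ * m) (- k) ⟩
        (- 1ℤ - b′ * m) %ℕ a                    ≡⟨ %ℕ-reflect (b′ * m) ⟩
        j                                       ∎

    -- The value is `r - j` with natural numbers `r` and `j` whose sum is `a - 1`.
    ∣saw∣≤ : ∀ b′ m → ∣ saw b′ m ∣ ≤ⁿ a ∸ 1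
    ∣saw∣≤ b′ m = subst (λ x → ∣ x ∣ ≤ⁿ a ∸ 1) (sym asDifference)
      (ℕₚ.≤-trans (ℤₚ.∣i-j∣≤∣i∣+∣j∣ (+ r) (+ j)) (ℕₚ.≤-reflexive r+j))
      where
      r = (b′ * m) %ℕ a
      j = a ∸ suc r
      r+j : r ℕᵇ.+ j ≡ a ∸ 1
      r+j = sym (cong (_∸ 1) (ℤₚ.+-injective (%ℕ-complement (b′ * m))))
      difference : ∀ r j → + 2 * r - (1ℤ + r + j - 1ℤ) ≡ r - j
      difference = solve-∀
      asDifference : saw b′ m ≡ + r - + j
      asDifference = trans (cong (λ y → + 2 * + r - (y - 1ℤ)) (%ℕ-complement (b′ * m)))
        (difference (+ r) (+ j))

    -- Sums of periodic functions along arithmetic progressions.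

    module _ (G : ℤ → ℤ) (periodic : ∀ m k → G (m + k * + a) ≡ G m)
             (c c′ k : ℤ) (inv : c * c′ ≡ 1ℤ + k * + a) where

      private
        window : ℤ → ℤ
        window N = Σ< (λ z → G (N + c * + z)) a

        window-step : ∀ N → window (N + c) ≡ window N
        window-step N = ∙-cancelˡ (F 0) _ _ (begin
          F 0 + Σ< (λ z → G (N + c + c * + z)) a
            ≡⟨ cong (_+_ (F 0)) (Σ<-cong a λ z → cong G (shift N c (+ z))) ⟩
          F 0 + Σ< (F ∘ suc) a
            ≡⟨ Σ<-head F a ⟨
          Σ< F a + F a
            -- The entering term `F a` is `G` at `N + c * + a`, which periodicity identifies with
            -- the leaving term `F 0`.
            ≡⟨ cong (_+_ (Σ< F a)) (trans (periodic N c) (cong G (sym (at-0 N c)))) ⟩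
          Σ< F a + F 0
            ≡⟨ ℤₚ.+-comm (Σ< F a) (F 0) ⟩
          F 0 + Σ< F a ∎)
          where
          F : ℕ → ℤ
          F z = G (N + c * + z)
          shift : ∀ N c z → N + c + c * z ≡ N + c * (1ℤ + z)
          shift = solve-∀
          at-0 : ∀ N c → N + c * 0ℤ ≡ N
          at-0 = solve-∀

        window-steps : ∀ N j → window (N + c * + j) ≡ window N
        window-steps N zero    = cong window (at-0 N c)
          where
          at-0 : ∀ N c → N + c * 0ℤ ≡ N
          at-0 = solve-∀
        window-steps N (suc j) = begin
          window (N + c * + suc j)   ≡⟨ cong window (shift N c (+ j)) ⟩
          window (N + c * + j + c)   ≡⟨ window-step (N + c * + j) ⟩
          window (N + c * + j)       ≡⟨ window-steps N j ⟩
          window N                   ∎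
          where
          shift : ∀ N c z → N + c * (1ℤ + z) ≡ N + c * z + c
          shift = solve-∀

        window-periodic : ∀ N l → window (N + l * + a) ≡ window N
        window-periodic N l = Σ<-cong a λ z →
          trans (cong G (swap N (l * + a) (c * + z))) (periodic (N + c * + z) l)
          where
          swap : ∀ x y z → x + y + z ≡ x + z + y
          swap = solve-∀

        -- c generates ℤ/a, so every window is reached from every other by steps of c.
        window-const : ∀ N M → window M ≡ window N
        window-const N M = begin
          window M
            -- `j` solves `N + c * j ≡ M` modulo `a`, and `l` counts the periods left over. The two
            -- corrections vanish by `inv` and by division with remainder.
            ≡⟨ cong window (rewriteM M N c c′ k (+ a) (+ j) q) ⟩
          window (N + c * + j + l * + a + ((1ℤ + k * + a - c * c′) * (M - N)
                   + c * (c′ * (M - N) - (+ j + q * + a))))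
            ≡⟨ cong₂ (λ x y → window (N + c * + j + l * + a + (x * (M - N) + c * y)))
                 (ℤₚ.i≡j⇒i-j≡0 (sym inv))
                 (ℤₚ.i≡j⇒i-j≡0 (ℤᵈ.a≡a%ℕn+[a/ℕn]*n (c′ * (M - N)) a)) ⟩
          window (N + c * + j + l * + a + (0ℤ * (M - N) + c * 0ℤ))
            ≡⟨ cong window (drop (N + c * + j + l * + a) (M - N) c) ⟩
          window (N + c * + j + l * + a)
            ≡⟨ window-periodic (N + c * + j) l ⟩
          window (N + c * + j)
            ≡⟨ window-steps N j ⟩
          window N ∎
          where
          j = (c′ * (M - N)) %ℕ a
          q = (c′ * (M - N)) /ℕ a
          l = c * q - k * (M - N)
          rewriteM : ∀ M N c c′ k a j q →
            M ≡ N + c * j + (c * q - k * (M - N)) * a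
                + ((1ℤ + k * a - c * c′) * (M - N) + c * (c′ * (M - N) - (j + q * a)))
          rewriteM = solve-∀
          drop : ∀ x y c → x + (0ℤ * y + c * 0ℤ) ≡ x
          drop = solve-∀

      -- Reflecting a window negates its sum but yields another window, and all windows
      -- have equal sums.
      window-sum≡0 : ∀ B → (∀ m → G (B - m) ≡ - G m) → ∀ N → Σ< (λ z → G (N + c * + z)) a ≡ 0ℤ
      window-sum≡0 B reflect N = i≡-i⇒i≡0 (begin
        window N
          ≡⟨ Σ<-reverse (λ z → G (N + c * + z)) a ⟩
        Σ< (λ z → G (N + c * + (a ∸ suc z))) a
          ≡⟨ Σ<-cong-< a reflected ⟩
        Σ< (λ z → - G (N′ + c * + z)) a
          ≡⟨ Σ<-neg (λ z → G (N′ + c * + z)) a ⟩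
        - window N′
          ≡⟨ cong -_ (window-const N N′) ⟩
        - window N ∎)
        where
        N′ : ℤ
        -- Chosen so that reflection in `B` carries term `z` of the window at `N′` to term
        -- `a - 1 - z` of the window at `N`.
        N′ = B - N - c * (+ a - 1ℤ)
        i≡-i⇒i≡0 : ∀ {i} → i ≡ - i → i ≡ 0ℤ
        i≡-i⇒i≡0 {+ zero}   _  = refl
        i≡-i⇒i≡0 {+[1+ _ ]} ()
        i≡-i⇒i≡0 { -[1+ _ ]} ()
        argument : ∀ B N c z j → B - (B - N - c * (1ℤ + z + j - 1ℤ) + c * z) ≡ N + c * j
        argument = solve-∀
        reflected : ∀ z → z <ⁿ a → G (N + c * + (a ∸ suc z)) ≡ - G (N′ + c * + z)
        reflected z z<a = begin
          G (N + c * + (a ∸ suc z))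
            ≡⟨ cong G (argument B N c (+ z) (+ (a ∸ suc z))) ⟨
          G (B - (B - N - c * (+ (suc z ℕᵇ.+ (a ∸ suc z)) - 1ℤ) + c * + z))
            ≡⟨ cong (λ y → G (B - (B - N - c * (+ y - 1ℤ) + c * + z))) (ℕₚ.m+[n∸m]≡n z<a) ⟩
          G (B - (N′ + c * + z))
            ≡⟨ reflect (N′ + c * + z) ⟩
          - G (N′ + c * + z) ∎

    periodic-Σ< : ∀ g → (∀ z → g (a ℕᵇ.+ z) ≡ g z) → Σ< g a ≡ 0ℤ →
      ∀ q t → Σ< g (q ℕᵇ.* a ℕᵇ.+ t) ≡ Σ< g t
    periodic-Σ< g periodic mean zero    t = refl
    periodic-Σ< g periodic mean (suc q) t = begin
      Σ< g (a ℕᵇ.+ q ℕᵇ.* a ℕᵇ.+ t)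
        ≡⟨ cong (Σ< g) (ℕₚ.+-assoc a (q ℕᵇ.* a) t) ⟩
      Σ< g (a ℕᵇ.+ (q ℕᵇ.* a ℕᵇ.+ t))
        ≡⟨ Σ<-split g a _ ⟩
      Σ< g a + Σ< (λ i → g (a ℕᵇ.+ i)) (q ℕᵇ.* a ℕᵇ.+ t)
        ≡⟨ cong₂ _+_ mean (Σ<-cong (q ℕᵇ.* a ℕᵇ.+ t) periodic) ⟩
      0ℤ + Σ< g (q ℕᵇ.* a ℕᵇ.+ t)
        ≡⟨ ℤₚ.+-identityˡ _ ⟩
      Σ< g (q ℕᵇ.* a ℕᵇ.+ t)
        ≡⟨ periodic-Σ< g periodic mean q t ⟩
      Σ< g t ∎

    -- Full periods cancel, which leaves `n % a` terms, at most `a - 1` of them.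
    ∣periodic-Σ<∣≤ : ∀ g {K} → (∀ z → g (a ℕᵇ.+ z) ≡ g z) → Σ< g a ≡ 0ℤ →
      (∀ z → ∣ g z ∣ ≤ⁿ K) → ∀ n → ∣ Σ< g n ∣ ≤ⁿ (a ∸ 1) ℕᵇ.* K
    ∣periodic-Σ<∣≤ g {K} periodic mean bound n = subst (λ x → ∣ x ∣ ≤ⁿ (a ∸ 1) ℕᵇ.* K) (sym reduce)
      (ℕₚ.≤-trans (∣Σ<∣≤ g t bound) (ℕₚ.*-monoˡ-≤ K (ℕₚ.<⇒≤pred (ℕᵈ.m%n<n n a))))
      where
      t = n ℕᵇ.% a
      reduce : Σ< g n ≡ Σ< g t
      reduce = trans
        (cong (Σ< g) (trans (ℕᵈ.m≡m%n+[m/n]*n n a) (ℕₚ.+-comm t _)))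
        (periodic-Σ< g periodic mean (n ℕᵇ./ a) t)

    -- As a function of `z` the summand has period `a`, since `a` steps move the argument by
    -- `c * a`. Its sum over a period is 0 by the reflection in `- b`.
    ∣Σ<saw∣≤ : ∀ b b′ k c c′ l → b * b′ ≡ 1ℤ + k * + a → c * c′ ≡ 1ℤ + l * + a →
      ∀ N n → ∣ Σ< (λ z → saw b′ (N + c * + z)) n ∣ ≤ⁿ (a ∸ 1) ℕᵇ.* (a ∸ 1)
    ∣Σ<saw∣≤ b b′ k c c′ l b-inv c-inv N = ∣periodic-Σ<∣≤ (λ z → saw b′ (N + c * + z))
      (λ z → trans (cong (saw b′) (shift N c (+ a) (+ z))) (saw-periodic b′ (N + c * + z) c))
      (window-sum≡0 (saw b′) (saw-periodic b′) c c′ l c-inv (- b) (saw-reflect b b′ k b-inv) N)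
      (λ z → ∣saw∣≤ b′ (N + c * + z))
      where
      shift : ∀ N c a z → N + c * (a + z) ≡ N + c * z + c * a
      shift = solve-∀

  -- Popoviciu's formula for two coprime parts.

  diff-pos : ∀ {i j} → i < j → 0ℤ < j - i
  diff-pos {i} {j} i<j = subst (_< j - i) (ℤₚ.+-inverseʳ i) (ℤₚ.+-monoˡ-< (- i) i<j)

  pos-nonneg : ∀ n → 0ℤ ≤ + n
  pos-nonneg n = ℤᵇ.+≤+ z≤n

  +-nonneg : ∀ {x y} → 0ℤ ≤ x → 0ℤ ≤ y → 0ℤ ≤ x + y
  +-nonneg = ℤₚ.+-mono-≤

  *-nonneg : ∀ {x y} → 0ℤ ≤ x → 0ℤ ≤ y → 0ℤ ≤ x * y
  *-nonneg {+ m} {+ n} _ _ = subst (0ℤ ≤_) (ℤₚ.pos-* m n) (pos-nonneg (m ℕᵇ.* n))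

  sub-nonneg : ∀ x {y} → 0ℤ ≤ y → x - y ≤ x
  sub-nonneg x {+ n} _ = ℤₚ.i-j≤i x (+ n)

  -- For m ≥ 0 this is ab times the number of representations of m by a and b, when a′ and b′
  -- are the inverses of a modulo b and of b modulo a.
  popoviciu : ∀ a b .{{_ : NonZero a}} .{{_ : NonZero b}} → ℤ → ℤ → ℤ → ℤ
  popoviciu a b a′ b′ m = m + + a * + b - + b * + ((b′ * m) %ℕ a) - + a * + ((a′ * m) %ℕ b)

  -- Each remainder is replaced by its deviation from the mean. The means contribute
  -- `b(a - 1) + a(b - 1)`, which turns the constant `2ab` into `a + b`; doubling avoids halves.
  2*popoviciu : ∀ a b .{{_ : NonZero a}} .{{_ : NonZero b}} a′ b′ m → + 2 * popoviciu a b a′ b′ m ≡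
    + 2 * m + (+ a + + b) - + b * saw a b′ m - + a * saw b a′ m
  2*popoviciu a b a′ b′ m = identity m (+ a) (+ b) (+ ((b′ * m) %ℕ a)) (+ ((a′ * m) %ℕ b))
    where
    identity : ∀ m a b u v → + 2 * (m + a * b - b * u - a * v) ≡
      + 2 * m + (a + b) - b * (+ 2 * u - (a - 1ℤ)) - a * (+ 2 * v - (b - 1ℤ))
    identity = solve-∀

  module _ (a b : ℕ) .{{_ : NonZero a}} .{{_ : NonZero b}} (a′ b′ k l : ℤ)
           (b-inv : + b * b′ ≡ 1ℤ + k * + a) (a-inv : + a * a′ ≡ 1ℤ + l * + b) where

    private
      u v : ℤ → ℕ
      u m = (b′ * m) %ℕ a
      v m = (a′ * m) %ℕ b

      h : ℤ → ℤ
      h = popoviciu a b a′ b′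

      u-periodic : ∀ m → u (m - + a) ≡ u m
      u-periodic m = trans (cong (_%ℕ a) (expand b′ m (+ a))) (%ℕ-periodic a (b′ * m) (- b′))
        where
        expand : ∀ b m a → b * (m - a) ≡ b * m + - b * a
        expand = solve-∀

      v-periodic : ∀ m → v (m - + b) ≡ v m
      v-periodic m = trans (cong (_%ℕ b) (expand a′ m (+ b))) (%ℕ-periodic b (a′ * m) (- a′))
        where
        expand : ∀ b m a → b * (m - a) ≡ b * m + - b * a
        expand = solve-∀

      -- `T a` kills the `a`-periodic term and makes the linear part constant; `T b` kills that
      -- constant and the `b`-periodic term.
      h-second-difference : ∀ m → T b (T a h) m ≡ 0ℤ
      h-second-difference m = begin
        h m - h (m - + a) - (h (m - + b) - h (m - + b - + a))
          ≡⟨ cong₂ (λ x y → h m - x - y) (cong (λ w → form (m - + a) w (v (m - + a))) (u-periodic m))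
               (cong₂ _-_ (cong (form (m - + b) (u (m - + b))) (v-periodic m))
                 (cong₂ (form (m - + b - + a)) (u-periodic (m - + b)) v-periodic₂)) ⟩
        form m (u m) (v m) - form (m - + a) (u m) (v (m - + a))
          - (form (m - + b) (u (m - + b)) (v m) - form (m - + b - + a) (u (m - + b)) (v (m - + a)))
          ≡⟨ vanish m (+ a) (+ b) (+ u m) (+ v m) (+ u (m - + b)) (+ v (m - + a)) ⟩
        0ℤ ∎
        where
        form : ℤ → ℕ → ℕ → ℤ
        form m x y = m + + a * + b - + b * + x - + a * + y
        swap : ∀ x y z → x - y - z ≡ x - z - y
        swap = solve-∀
        v-periodic₂ : v (m - + b - + a) ≡ v (m - + a)
        v-periodic₂ = trans (cong v (swap m (+ b) (+ a))) (v-periodic (m - + a))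
        vanish : ∀ m a b u v u′ v′ →
          m + a * b - b * u - a * v - (m - a + a * b - b * u - a * v′)
          - (m - b + a * b - b * u′ - a * v - (m - b - a + a * b - b * u′ - a * v′)) ≡ 0ℤ
        vanish = solve-∀

      -- Modulo `a`, `h m` is `m - b * b′ * m`, hence 0; likewise modulo `b`. From
      -- `h m = a * x = b * y`, multiplication by `1 = b * b′ - k * a` gives
      -- `a * b * (b′ * x - k * y)`.
      h-multiple : ∀ m → Σ[ t ∈ ℤ ] h m ≡ t * + (a ℕᵇ.* b)
      h-multiple m = b′ * x - k * y , (begin
        h m
          ≡⟨ a-multiple ⟩
        + a * x
          ≡⟨ split (+ a) (+ b) b′ k x y ⟩
        (b′ * x - k * y) * (+ a * + b) + + a * x * (1ℤ + k * + a - + b * b′) + k * + a * (+ b * y - + a * x)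
          ≡⟨ cong₂ (λ i j → (b′ * x - k * y) * (+ a * + b) + + a * x * i + k * + a * j)
               (ℤₚ.i≡j⇒i-j≡0 (sym b-inv)) (ℤₚ.i≡j⇒i-j≡0 (trans (sym b-multiple) a-multiple)) ⟩
        (b′ * x - k * y) * (+ a * + b) + + a * x * 0ℤ + k * + a * 0ℤ
          ≡⟨ drop ((b′ * x - k * y) * (+ a * + b)) (+ a * x) (k * + a) ⟩
        (b′ * x - k * y) * (+ a * + b)
          ≡⟨ cong (_*_ (b′ * x - k * y)) (ℤₚ.pos-* a b) ⟨
        (b′ * x - k * y) * + (a ℕᵇ.* b) ∎)
        where
        p q x y : ℤ
        p = (b′ * m) /ℕ a
        q = (a′ * m) /ℕ b
        x = + b - k * m + + b * p - + v m
        y = + a - l * m + + a * q - + u m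
        split : ∀ a b b′ k x y → a * x ≡
          (b′ * x - k * y) * (a * b) + a * x * (1ℤ + k * a - b * b′) + k * a * (b * y - a * x)
        split = solve-∀
        drop : ∀ z x y → z + x * 0ℤ + y * 0ℤ ≡ z
        drop = solve-∀
        identity : ∀ m a b b′ k p u v →
          m + a * b - b * u - a * v ≡ a * (b - k * m + b * p - v)
            + (m * (1ℤ + k * a - b * b′) + b * (b′ * m - (u + p * a)))
        identity = solve-∀
        cleanup : ∀ z m b → z + (m * 0ℤ + b * 0ℤ) ≡ z
        cleanup = solve-∀
        multiple : ∀ A B B′ K P U V → B * B′ ≡ 1ℤ + K * A → B′ * m ≡ U + P * A →
          m + A * B - B * U - A * V ≡ A * (B - K * m + B * P - V)
        multiple A B B′ K P U V inv div = begin
          m + A * B - B * U - A * V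
            ≡⟨ identity m A B B′ K P U V ⟩
          A * (B - K * m + B * P - V) + (m * (1ℤ + K * A - B * B′) + B * (B′ * m - (U + P * A)))
            ≡⟨ cong₂ (λ i j → A * (B - K * m + B * P - V) + (m * i + B * j))
                 (ℤₚ.i≡j⇒i-j≡0 (sym inv)) (ℤₚ.i≡j⇒i-j≡0 div) ⟩
          A * (B - K * m + B * P - V) + (m * 0ℤ + B * 0ℤ)
            ≡⟨ cleanup (A * (B - K * m + B * P - V)) m B ⟩
          A * (B - K * m + B * P - V) ∎
        a-multiple : h m ≡ + a * x
        a-multiple = multiple (+ a) (+ b) b′ k p (+ u m) (+ v m) b-inv
          (ℤᵈ.a≡a%ℕn+[a/ℕn]*n (b′ * m) a)
        exchange : ∀ m a b u v → m + a * b - b * u - a * v ≡ m + b * a - a * v - b * u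
        exchange = solve-∀
        b-multiple : h m ≡ + b * y
        b-multiple = trans (exchange m (+ a) (+ b) (+ u m) (+ v m))
          (multiple (+ b) (+ a) a′ l q (+ v m) (+ u m) a-inv (ℤᵈ.a≡a%ℕn+[a/ℕn]*n (a′ * m) b))

      -- As `h m` is a multiple of `ab`, it suffices that it lies strictly between `-ab` and `ab`.
      -- Nonnegative remainders give `h m ≤ m + ab`; remainders at most `a - 1` and `b - 1` give
      -- `h m ≥ m + a + b - ab`.
      h≡0 : ∀ m → - (+ a + + b) < m → m < 0ℤ → h m ≡ 0ℤ
      h≡0 m -a-b<m m<0 =
        multiple-small⇒0 (a ℕᵇ.* b) (proj₁ (h-multiple m)) (proj₂ (h-multiple m)) lower upper
        where
        u′ = a ∸ suc (u m)
        v′ = b ∸ suc (v m)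
        lower-identity : ∀ m u v u′ v′ →
          - ((1ℤ + u + u′) * (1ℤ + v + v′)) + ((m - - (1ℤ + u + u′ + (1ℤ + v + v′)))
            + ((1ℤ + v + v′) * u′ + (1ℤ + u + u′) * v′)) ≡
          m + (1ℤ + u + u′) * (1ℤ + v + v′) - (1ℤ + v + v′) * u - (1ℤ + u + u′) * v
        lower-identity = solve-∀
        lower-identity′ : - (+ a * + b) + ((m - - (+ a + + b)) + (+ b * + u′ + + a * + v′)) ≡ h m
        lower-identity′ = subst₂ (λ A B → - (A * B) + ((m - - (A + B)) + (B * + u′ + A * + v′))
            ≡ m + A * B - B * + u m - A * + v m)
          (sym (%ℕ-complement a (b′ * m))) (sym (%ℕ-complement b (a′ * m)))
          (lower-identity m (+ u m) (+ v m) (+ u′) (+ v′))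
        lower : - + (a ℕᵇ.* b) < h m
        lower = subst₂ _<_ (trans (ℤₚ.+-identityʳ _) (cong -_ (sym (ℤₚ.pos-* a b)))) lower-identity′
          (ℤₚ.+-monoʳ-< (- (+ a * + b)) (ℤₚ.+-mono-<-≤ (diff-pos -a-b<m)
            (+-nonneg (*-nonneg (pos-nonneg b) (pos-nonneg u′)) (*-nonneg (pos-nonneg a) (pos-nonneg v′)))))
        upper-identity : ∀ m a b u v → a * b - (b * u + a * v) + m ≡ m + a * b - b * u - a * v
        upper-identity = solve-∀
        upper : h m < + (a ℕᵇ.* b)
        upper = subst₂ _<_ (upper-identity m (+ a) (+ b) (+ u m) (+ v m))
          (trans (ℤₚ.+-identityʳ _) (sym (ℤₚ.pos-* a b)))
          (ℤₚ.+-mono-≤-< (sub-nonneg (+ a * + b)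
            (+-nonneg (*-nonneg (pos-nonneg b) (pos-nonneg (u m))) (*-nonneg (pos-nonneg a) (pos-nonneg (v m))))) m<0)

      h0 : h 0ℤ ≡ + a * + b
      h0 = trans (cong₂ (λ x y → 0ℤ + + a * + b - + b * + x - + a * + y) (zero-residue a b′) (zero-residue b a′))
        (simplify (+ a) (+ b))
        where
        zero-residue : ∀ d .{{_ : NonZero d}} x → (x * 0ℤ) %ℕ d ≡ 0
        zero-residue d x = %ℕ-unique d (x * 0ℤ) 0 0ℤ (ℕₚ.n≢0⇒n>0 (ℕᵇ.≢-nonZero⁻¹ d)) (ℤₚ.*-zeroʳ x)
        simplify : ∀ a b → 0ℤ + a * b - b * 0ℤ - a * 0ℤ ≡ a * b
        simplify = solve-∀

    -- h − ab·G is killed by the difference operators of steps a and b and vanishes on the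
    -- a + b − 1 arguments below 0 and at 0, hence everywhere above.
    popoviciu-formula : ∀ G → (∀ {m} → m < 0ℤ → G m ≡ 0ℤ) → T b (T a G) ≗ ext 𝟙 →
      ∀ n → + a * + b * G (+ n) ≡ popoviciu a b a′ b′ (+ n)
    popoviciu-formula G G-neg rec = <-rec _ step
      where
      a>0 : 0 <ⁿ a
      a>0 = ℕₚ.n≢0⇒n>0 (ℕᵇ.≢-nonZero⁻¹ a)
      b>0 : 0 <ⁿ b
      b>0 = ℕₚ.n≢0⇒n>0 (ℕᵇ.≢-nonZero⁻¹ b)

      step : ∀ n → (∀ {i} → i <ⁿ n → + a * + b * G (+ i) ≡ h (+ i)) → + a * + b * G (+ n) ≡ h (+ n)
      -- At 0 the second difference of `G` is 1 while that of `h` is 0, so the common recursion does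
      -- not apply and both sides are evaluated.
      step zero _ = trans (trans (cong (_*_ (+ a * + b)) G0) (ℤₚ.*-identityʳ _)) (sym h0)
        where
        unfold : ∀ x y z w → x ≡ x - y - (z - w) + (y + (z - w))
        unfold = solve-∀
        neg : ∀ i d → i ≤ 0ℤ → 0 <ⁿ d → i - + d < 0ℤ
        neg i d i≤0 d>0 = ℤₚ.+-mono-≤-< i≤0 (ℤₚ.neg-mono-< (ℤᵇ.+<+ d>0))
        G0 : G 0ℤ ≡ 1ℤ
        G0 = begin
          G 0ℤ
            ≡⟨ unfold (G 0ℤ) (G (0ℤ - + a)) (G (0ℤ - + b)) (G (0ℤ - + b - + a)) ⟩
          T b (T a G) 0ℤ + (G (0ℤ - + a) + (G (0ℤ - + b) - G (0ℤ - + b - + a)))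
            ≡⟨ cong₂ _+_ (rec 0ℤ) (cong₂ _+_ (G-neg (neg 0ℤ a ℤₚ.≤-refl a>0))
                 (cong₂ _-_ (G-neg (neg 0ℤ b ℤₚ.≤-refl b>0))
                   (G-neg (neg (0ℤ - + b) a (ℤₚ.<⇒≤ (neg 0ℤ b ℤₚ.≤-refl b>0)) a>0)))) ⟩
          1ℤ ∎
      step (suc n) ih = begin
        d * G m
          ≡⟨ expand d (G m) (G (m - + a)) (G (m - + b)) (G (m - + b - + a)) ⟩
        d * T b (T a G) m + (d * G (m - + a) + d * G (m - + b) - d * G (m - + b - + a))
          ≡⟨ cong₂ (λ x y → d * x + y) (rec m)
               (cong₂ _-_ (cong₂ _+_ (earlier (m - + a) m-a> m-a<) (earlier (m - + b) m-b> m-b<))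
                 (earlier (m - + b - + a) m-b-a> m-b-a<)) ⟩
        d * 0ℤ + (h (m - + a) + h (m - + b) - h (m - + b - + a))
          ≡⟨ cong (_+ (h (m - + a) + h (m - + b) - h (m - + b - + a)))
               (trans (ℤₚ.*-zeroʳ d) (sym (h-second-difference m))) ⟩
        T b (T a h) m + (h (m - + a) + h (m - + b) - h (m - + b - + a))
          ≡⟨ collapse (h m) (h (m - + a)) (h (m - + b)) (h (m - + b - + a)) ⟩
        h m ∎
        where
        m d : ℤ
        m = + suc n
        d = + a * + b
        expand : ∀ d x y z w → d * x ≡ d * (x - y - (z - w)) + (d * y + d * z - d * w)
        expand = solve-∀
        collapse : ∀ x y z w → x - y - (z - w) + (y + z - w) ≡ x
        collapse = solve-∀
        earlier : ∀ x → - (+ a + + b) < x → x < m → d * G x ≡ h x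
        earlier (+ i)    _  (ℤᵇ.+<+ i<n) = ih i<n
        -- The induction hypothesis covers only natural arguments; between `-(a + b)` and 0 both
        -- sides vanish.
        earlier -[1+ i ] lo _ = begin
          d * G -[1+ i ]   ≡⟨ cong (_*_ d) (G-neg ℤᵇ.-<+) ⟩
          d * 0ℤ           ≡⟨ ℤₚ.*-zeroʳ d ⟩
          0ℤ               ≡⟨ h≡0 -[1+ i ] lo ℤᵇ.-<+ ⟨
          h -[1+ i ]       ∎
        drop : ∀ x i → 0 <ⁿ i → x - + i < x
        drop x i i>0 = subst (x - + i <_) (ℤₚ.+-identityʳ x)
          (ℤₚ.+-monoʳ-< x (ℤₚ.neg-mono-< (ℤᵇ.+<+ i>0)))
        m-a< = drop m a a>0
        m-b< = drop m b b>0
        m-b-a< = ℤₚ.<-trans (drop (m - + b) a a>0) m-b<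
        bottom : ∀ x y m → - (x + y) + m ≡ m - y - x
        bottom = solve-∀
        -- The lowest of the three arguments: `m ≥ 1` keeps it above `-(a + b)`, and the bounds for
        -- the other two follow from it.
        m-b-a> : - (+ a + + b) < m - + b - + a
        m-b-a> = subst₂ _<_ (ℤₚ.+-identityʳ _) (bottom (+ a) (+ b) m)
          (ℤₚ.+-monoʳ-< (- (+ a + + b)) (ℤᵇ.+<+ (s≤s z≤n)))
        m-b> = ℤₚ.<-trans m-b-a> (drop (m - + b) a a>0)
        m-a> : - (+ a + + b) < m - + a
        m-a> = ℤₚ.<-trans m-b-a> (subst (_< m - + a) (swap m (+ a) (+ b)) (drop (m - + a) b b>0))
          where
          swap : ∀ x y z → x - y - z ≡ x - z - y
          swap = solve-∀

  -- Summation over a residue class modulo `c`.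

  modular-inverse : ∀ {m n} → Coprime m n → ∃₂ λ x y → + n * x ≡ 1ℤ + y * + m
  modular-inverse {m} {n} coprime with Coprimality.coprime-Bézout coprime
  ... | Bézout.-+ x y eq = + y , + x , (begin
    + n * + y             ≡⟨ ℤₚ.*-comm (+ n) (+ y) ⟩
    + y * + n             ≡⟨ ℤₚ.pos-* y n ⟨
    + (y ℕᵇ.* n)          ≡⟨ cong +_ eq ⟨
    1ℤ + + (x ℕᵇ.* m)     ≡⟨ cong (_+_ 1ℤ) (ℤₚ.pos-* x m) ⟩
    1ℤ + + x * + m        ∎)
  ... | Bézout.+- x y eq = - + y , - + x , (begin
    + n * - + y                    ≡⟨ identity (+ n) (+ y) ⟩
    1ℤ + - (1ℤ + + y * + n)        ≡⟨ cong (λ i → 1ℤ + - i) eq′ ⟩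
    1ℤ + - (+ x * + m)             ≡⟨ cong (_+_ 1ℤ) (ℤₚ.neg-distribˡ-* (+ x) (+ m)) ⟩
    1ℤ + - + x * + m               ∎)
    where
    identity : ∀ n y → n * - y ≡ 1ℤ + - (1ℤ + y * n)
    identity = solve-∀
    eq′ : 1ℤ + + y * + n ≡ + x * + m
    eq′ = trans (cong (_+_ 1ℤ) (sym (ℤₚ.pos-* y n))) (trans (cong +_ eq) (ℤₚ.pos-* x m))

  module _ (a b c : ℕ) .{{_ : NonZero a}} .{{_ : NonZero b}} .{{_ : NonZero c}}
           (a⊥b : Coprime a b) (a⊥c : Coprime a c) (b⊥c : Coprime b c)
           (p : Series) (recip : p IsReciprocalOf (1-q^ a ⊛ 1-q^ b ⊛ 1-q^ c)) where

    private
      P : ℤ → ℤ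
      P = ext p

      b-inv = modular-inverse a⊥b
      a-inv = modular-inverse (Coprimality.sym a⊥b)
      c-inv-a = modular-inverse a⊥c
      c-inv-b = modular-inverse b⊥c

      b′ a′ k l : ℤ
      b′ = proj₁ b-inv
      a′ = proj₁ a-inv
      k  = proj₁ (proj₂ b-inv)
      l  = proj₁ (proj₂ a-inv)

      h : ℤ → ℤ
      h = popoviciu a b a′ b′

      Tc-formula : ∀ n → + a * + b * T c P (+ n) ≡ h (+ n)
      Tc-formula = popoviciu-formula a b a′ b′ k l (proj₂ (proj₂ b-inv)) (proj₂ (proj₂ a-inv)) (T c P)
        (λ {m} m<0 → cong₂ _-_ (ext-neg p m<0) (ext-neg p (ℤₚ.≤-<-trans (ℤₚ.i-j≤i m (+ c)) m<0)))
        (reciprocal⇒T a b c p recip)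

      module _ (w : ℕ) (w<c : w <ⁿ c) where

        term-a term-b : ℕ → ℤ
        term-a z = saw a b′ (+ w + + c * + z)
        term-b z = saw b a′ (+ w + + c * + z)

        -- `T c P` telescopes along `w + c z` for `z < k`, and Popoviciu's formula evaluates each
        -- term. Writing the argument as `w + c k - c` makes the case `k = 0` the negative number
        -- `w - c`, where `P` vanishes.
        summed : ∀ k → + 2 * (+ a * + b) * P (+ w + + c * + k - + c) ≡
          + k * (+ 2 * + w + + c * (+ k - 1ℤ) + (+ a + + b)) - + b * Σ< term-a k - + a * Σ< term-b k
        summed zero = begin
          + 2 * (+ a * + b) * P (+ w + + c * 0ℤ - + c)
            ≡⟨ cong (λ x → + 2 * (+ a * + b) * P (x - + c)) (at-0 (+ w) (+ c)) ⟩
          + 2 * (+ a * + b) * P (+ w - + c)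
            ≡⟨ cong (_*_ (+ 2 * (+ a * + b))) (ext-neg p (sub-neg c (ℤᵇ.+<+ w<c))) ⟩
          + 2 * (+ a * + b) * 0ℤ
            ≡⟨ vanish (+ a) (+ b) (+ 2 * + w + + c * (0ℤ - 1ℤ) + (+ a + + b)) ⟩
          0ℤ * (+ 2 * + w + + c * (0ℤ - 1ℤ) + (+ a + + b)) - + b * 0ℤ - + a * 0ℤ ∎
          where
          at-0 : ∀ x y → x + y * 0ℤ ≡ x
          at-0 = solve-∀
          vanish : ∀ a b x → + 2 * (a * b) * 0ℤ ≡ 0ℤ * x - b * 0ℤ - a * 0ℤ
          vanish = solve-∀
        summed (suc k) = begin
          + 2 * (+ a * + b) * P (+ w + + c * (1ℤ + + k) - + c)
            ≡⟨ cong (λ x → + 2 * (+ a * + b) * P x) (shift (+ w) (+ c) (+ k)) ⟩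
          + 2 * (+ a * + b) * P x
            ≡⟨ split (+ a) (+ b) (P x) (P (x - + c)) ⟩
          + 2 * (+ a * + b * T c P x) + + 2 * (+ a * + b) * P (x - + c)
            ≡⟨ cong₂ (λ y z → + 2 * y + z) formula-at-x (summed k) ⟩
          + 2 * h x + (+ k * (+ 2 * + w + + c * (+ k - 1ℤ) + (+ a + + b))
            - + b * Σ< term-a k - + a * Σ< term-b k)
            ≡⟨ cong (_+ (+ k * (+ 2 * + w + + c * (+ k - 1ℤ) + (+ a + + b))
                 - + b * Σ< term-a k - + a * Σ< term-b k)) (2*popoviciu a b a′ b′ x) ⟩
          + 2 * x + (+ a + + b) - + b * term-a k - + a * term-b k
            + (+ k * (+ 2 * + w + + c * (+ k - 1ℤ) + (+ a + + b)) - + b * Σ< term-a k - + a * Σ< term-b k)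
            ≡⟨ collect (+ a) (+ b) (+ c) (+ w) (+ k) (term-a k) (term-b k) (Σ< term-a k) (Σ< term-b k) ⟩
          (1ℤ + + k) * (+ 2 * + w + + c * (1ℤ + + k - 1ℤ) + (+ a + + b))
            - + b * (Σ< term-a k + term-a k) - + a * (Σ< term-b k + term-b k) ∎
          where
          x : ℤ
          x = + w + + c * + k
          x≡pos : x ≡ + (w ℕᵇ.+ c ℕᵇ.* k)
          x≡pos = cong (_+_ (+ w)) (sym (ℤₚ.pos-* c k))
          formula-at-x : + a * + b * T c P x ≡ h x
          formula-at-x = subst (λ y → + a * + b * T c P y ≡ h y) (sym x≡pos) (Tc-formula (w ℕᵇ.+ c ℕᵇ.* k))
          shift : ∀ w c k → w + c * (1ℤ + k) - c ≡ w + c * k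
          shift = solve-∀
          split : ∀ a b x y → + 2 * (a * b) * x ≡ + 2 * (a * b * (x - y)) + + 2 * (a * b) * y
          split = solve-∀
          collect : ∀ a b c w k s t S S′ →
            + 2 * (w + c * k) + (a + b) - b * s - a * t
              + (k * (+ 2 * w + c * (k - 1ℤ) + (a + b)) - b * S - a * S′) ≡
            (1ℤ + k) * (+ 2 * w + c * (1ℤ + k - 1ℤ) + (a + b)) - b * (S + s) - a * (S′ + t)
          collect = solve-∀

    -- w is n mod c, and σ, τ are the partial sums of the sawtooth terms modulo a and b.
    record Estimate (n : ℕ) : Set where
      field
        w : ℕ
        w<c : w <ⁿ c
        σ τ : ℤ
        ∣σ∣≤ : ∣ σ ∣ ≤ⁿ (a ∸ 1) ℕᵇ.* (a ∸ 1)
        ∣τ∣≤ : ∣ τ ∣ ≤ⁿ (b ∸ 1) ℕᵇ.* (b ∸ 1)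
        formula : + 2 * (+ a * + b * + c) * p n ≡
          + n * + n + + n * (+ a + + b + + c) + ((+ c - + w) * (+ w + (+ a + + b)) - + c * (+ b * σ + + a * τ))

    estimate : ∀ n → Estimate n
    estimate n = record
      { w       = w
      ; w<c     = w<c
      ; σ       = σ
      ; τ       = τ
      ; ∣σ∣≤    = ∣Σ<saw∣≤ a (+ b) b′ k (+ c) (proj₁ c-inv-a) (proj₁ (proj₂ c-inv-a))
                    (proj₂ (proj₂ b-inv)) (proj₂ (proj₂ c-inv-a)) (+ w) (suc Z)
      ; ∣τ∣≤    = ∣Σ<saw∣≤ b (+ a) a′ l (+ c) (proj₁ c-inv-b) (proj₁ (proj₂ c-inv-b))
                    (proj₂ (proj₂ a-inv)) (proj₂ (proj₂ c-inv-b)) (+ w) (suc Z)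
      ; formula = begin
          + 2 * (+ a * + b * + c) * p n
            ≡⟨ cong (λ x → + 2 * (+ a * + b * + c) * P x) (trans n≡w+cZ (unshift (+ w) (+ c) (+ Z))) ⟩
          + 2 * (+ a * + b * + c) * P (+ w + + c * + suc Z - + c)
            ≡⟨ reassoc (+ a) (+ b) (+ c) (P (+ w + + c * + suc Z - + c)) ⟩
          + c * (+ 2 * (+ a * + b) * P (+ w + + c * + suc Z - + c))
            ≡⟨ cong (_*_ (+ c)) (summed w w<c (suc Z)) ⟩
          + c * (+ suc Z * (+ 2 * + w + + c * (+ suc Z - 1ℤ) + (+ a + + b)) - + b * σ - + a * τ)
            ≡⟨ complete (+ a) (+ b) (+ c) (+ w) (+ Z) σ τ ⟩
          rhs (+ w + + c * + Z)
            ≡⟨ cong rhs n≡w+cZ ⟨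
          rhs (+ n) ∎
      }
      where
      w Z : ℕ
      w = n ℕᵇ.% c
      Z = n ℕᵇ./ c
      w<c : w <ⁿ c
      w<c = ℕᵈ.m%n<n n c
      σ τ : ℤ
      σ = Σ< (term-a w w<c) (suc Z)
      τ = Σ< (term-b w w<c) (suc Z)
      rhs : ℤ → ℤ
      rhs N = N * N + N * (+ a + + b + + c)
        + ((+ c - + w) * (+ w + (+ a + + b)) - + c * (+ b * σ + + a * τ))
      n≡w+cZ : + n ≡ + w + + c * + Z
      n≡w+cZ = begin
        + n                      ≡⟨ cong +_ (ℕᵈ.m≡m%n+[m/n]*n n c) ⟩
        + w + + (Z ℕᵇ.* c)       ≡⟨ cong (_+_ (+ w)) (trans (cong +_ (ℕₚ.*-comm Z c)) (ℤₚ.pos-* c Z)) ⟩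
        + w + + c * + Z          ∎
      unshift : ∀ w c z → w + c * z ≡ w + c * (1ℤ + z) - c
      unshift = solve-∀
      reassoc : ∀ a b c x → + 2 * (a * b * c) * x ≡ c * (+ 2 * (a * b) * x)
      reassoc = solve-∀
      -- With `n = w + c z`, the main term is `(n + c - w)(n + w + a + b)`, whose expansion
      -- separates `n² + n(a + b + c)` from a part depending only on `w`.
      complete : ∀ a b c w z σ τ →
        c * ((1ℤ + z) * (+ 2 * w + c * (1ℤ + z - 1ℤ) + (a + b)) - b * σ - a * τ) ≡
        (w + c * z) * (w + c * z) + (w + c * z) * (a + b + c)
          + ((c - w) * (w + (a + b)) - c * (b * σ + a * τ))
      complete = solve-∀

  -- The stated constants and the polynomial inequalities.

  P₂-numerator : ℤ → ℤ → ℤ → ℤ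
  P₂-numerator R S N = - 1ℤ + N ^ 2 + + 3 * R + N * (+ 3 * R - S) - S

  C₃ᵘ-numerator C₃ᵈ-numerator : ℤ → ℤ → ℤ
  C₃ᵘ-numerator R S =
    R ^ 3 * (+ 4 * S ^ 2 - + 2 * S)
    + R ^ 2 * (- (+ 10) * S ^ 3 + + 3 * S ^ 2 + + 4 * S)
    + R * (+ 8 * S ^ 4 - S ^ 3 - + 6 * S ^ 2 - + 2 * S - + 2)
    - + 2 * S ^ 5 + + 2 * S ^ 3 + + 2 * S ^ 2 + S + 1ℤ
  C₃ᵈ-numerator R S =
    R ^ 3 * (- (+ 4) * S ^ 2 - + 2 * S)
    + R ^ 2 * (+ 10 * S ^ 3 + + 3 * S ^ 2)
    + R * (- (+ 8) * S ^ 4 - S ^ 3 + + 2 * S - + 2)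
    + + 2 * S ^ 5 - + 2 * S ^ 2 + S + 1ℤ

  -- What the numerators of the two bounds leave beyond `n² + n(a + b + c)`, after the substitution
  -- `s = A`, `r = A + B`.
  upper-deviation lower-deviation : ℤ → ℤ → ℤ
  upper-deviation A B =
    A * B * (A + + 2 * B) * (+ 2 * (A * B) - (A + B) + + 2) + (A + B) - + 2 * (A * B)
  lower-deviation A B =
    - (A * B * (A + + 2 * B) * (+ 2 * (A * B) + (A + B))) + (A + B) + + 2 * (A * B)

  -- The powers are written out because the ring solver does not see through _^_.
  upper-numerator : ∀ A B N → P₂-numerator (A + B) A N + C₃ᵘ-numerator (A + B) A ≡
    N * N + N * (A + B + (A + + 2 * B)) + upper-deviation A B
  upper-numerator = expanded
    where
    expanded : ∀ A B N →
      - 1ℤ + (N * (N * 1ℤ)) + + 3 * (A + B) + N * (+ 3 * (A + B) - A) - A +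
      (((A + B) * ((A + B) * ((A + B) * 1ℤ))) * (+ 4 * (A * (A * 1ℤ)) - + 2 * A)
      + ((A + B) * ((A + B) * 1ℤ)) * (- (+ 10) * (A * (A * (A * 1ℤ))) + + 3 * (A * (A * 1ℤ)) + + 4 * A)
      + (A + B) * (+ 8 * (A * (A * (A * (A * 1ℤ)))) - (A * (A * (A * 1ℤ))) - + 6 * (A * (A * 1ℤ)) - + 2 * A - + 2)
      - + 2 * (A * (A * (A * (A * (A * 1ℤ))))) + + 2 * (A * (A * (A * 1ℤ))) + + 2 * (A * (A * 1ℤ)) + A + 1ℤ) ≡
      N * N + N * (A + B + (A + + 2 * B)) +
      (A * B * (A + + 2 * B) * (+ 2 * (A * B) - (A + B) + + 2) + (A + B) - + 2 * (A * B))
    expanded = solve-∀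

  lower-numerator : ∀ A B N → P₂-numerator (A + B) A N + C₃ᵈ-numerator (A + B) A ≡
    N * N + N * (A + B + (A + + 2 * B)) + lower-deviation A B
  lower-numerator = expanded
    where
    expanded : ∀ A B N →
      - 1ℤ + (N * (N * 1ℤ)) + + 3 * (A + B) + N * (+ 3 * (A + B) - A) - A +
      (((A + B) * ((A + B) * ((A + B) * 1ℤ))) * (- (+ 4) * (A * (A * 1ℤ)) - + 2 * A)
      + ((A + B) * ((A + B) * 1ℤ)) * (+ 10 * (A * (A * (A * 1ℤ))) + + 3 * (A * (A * 1ℤ)))
      + (A + B) * (- (+ 8) * (A * (A * (A * (A * 1ℤ)))) - (A * (A * (A * 1ℤ))) + + 2 * A - + 2)
      + + 2 * (A * (A * (A * (A * (A * 1ℤ))))) - + 2 * (A * (A * 1ℤ)) + A + 1ℤ) ≡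
      N * N + N * (A + B + (A + + 2 * B)) +
      (- (A * B * (A + + 2 * B) * (+ 2 * (A * B) + (A + B))) + (A + B) + + 2 * (A * B))
    expanded = solve-∀

  -- Both inequalities are proved by certificates: the difference `e` is an explicit sum of
  -- nonnegative terms, and the ring solver checks the equation.
  ≤-from-slack : ∀ {x y} e → 0ℤ ≤ e → x + e ≡ y → x ≤ y
  ≤-from-slack {x} {y} e 0≤e eq = subst₂ _≤_ (ℤₚ.+-identityʳ x) eq (ℤₚ.+-monoʳ-≤ x 0≤e)

  abs-bound : ∀ {K} x → ∣ x ∣ ≤ⁿ K → 0ℤ ≤ + K + x
  abs-bound (+ n)    _   = ℤᵇ.+≤+ z≤n
  abs-bound -[1+ n ] n<K = ℤₚ.i≤j⇒0≤j-i (ℤᵇ.+≤+ n<K)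

  squares-nonneg : ∀ m n → 0ℤ ≤ + m * + m + + m * + n + + n * + n
  squares-nonneg m n = +-nonneg
    (+-nonneg (*-nonneg (pos-nonneg m) (pos-nonneg m)) (*-nonneg (pos-nonneg m) (pos-nonneg n)))
    (*-nonneg (pos-nonneg n) (pos-nonneg n))

  -- Writing the larger number as the smaller plus `t` removes the negative term: with smaller
  -- number `m` the form becomes `m² + m t + t²`.
  quadratic-nonneg : ∀ m n → 0ℤ ≤ + m * + m - + m * + n + + n * + n
  quadratic-nonneg m n with ℕₚ.≤-total m n
  ... | inj₁ m≤n = subst (λ i → 0ℤ ≤ + m * + m - + m * + i + + i * + i) (ℕₚ.m+[n∸m]≡n m≤n)
    (subst (0ℤ ≤_) (identity (+ m) (+ (n ∸ m))) (squares-nonneg m (n ∸ m)))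
    where
    identity : ∀ m t → m * m + m * t + t * t ≡ m * m - m * (m + t) + (m + t) * (m + t)
    identity = solve-∀
  ... | inj₂ n≤m = subst (λ i → 0ℤ ≤ + i * + i - + i * + n + + n * + n) (ℕₚ.m+[n∸m]≡n n≤m)
    (subst (0ℤ ≤_) (identity (+ n) (+ (m ∸ n))) (squares-nonneg n (m ∸ n)))
    where
    identity : ∀ n t → n * n + n * t + t * t ≡ (n + t) * (n + t) - (n + t) * n + n * n
    identity = solve-∀

  module _ (a b c : ℕ) (1≤a : 1 ≤ⁿ a) (2≤b : 2 ≤ⁿ b) (c≡a+2b : + c ≡ + a + + 2 * + b)
           (w : ℕ) (w<c : w <ⁿ c) (σ τ : ℤ)
           (∣σ∣≤ : ∣ σ ∣ ≤ⁿ (a ∸ 1) ℕᵇ.* (a ∸ 1)) (∣τ∣≤ : ∣ τ ∣ ≤ⁿ (b ∸ 1) ℕᵇ.* (b ∸ 1)) where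

    private
      A B α β γ : ℤ
      A = + a
      B = + b
      α = A - 1ℤ
      β = B - 1ℤ
      γ = B - + 2

      0≤A : 0ℤ ≤ A
      0≤A = pos-nonneg a
      0≤B : 0ℤ ≤ B
      0≤B = pos-nonneg b
      0≤α : 0ℤ ≤ α
      0≤α = ℤₚ.i≤j⇒0≤j-i (ℤᵇ.+≤+ 1≤a)
      0≤β : 0ℤ ≤ β
      0≤β = ℤₚ.i≤j⇒0≤j-i (ℤᵇ.+≤+ (ℕₚ.<⇒≤ 2≤b))
      0≤γ : 0ℤ ≤ γ
      0≤γ = ℤₚ.i≤j⇒0≤j-i (ℤᵇ.+≤+ 2≤b)
      0≤2 : 0ℤ ≤ + 2
      0≤2 = pos-nonneg 2
      0≤C : 0ℤ ≤ A + + 2 * B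
      0≤C = +-nonneg 0≤A (*-nonneg 0≤2 0≤B)

      square-pred : ∀ {n} → 1 ≤ⁿ n → + ((n ∸ 1) ℕᵇ.* (n ∸ 1)) ≡ (+ n - 1ℤ) * (+ n - 1ℤ)
      square-pred {suc n} _ = ℤₚ.pos-* n n

      sum-nonneg : ∀ {n} x → 1 ≤ⁿ n → ∣ x ∣ ≤ⁿ (n ∸ 1) ℕᵇ.* (n ∸ 1) → 0ℤ ≤ (+ n - 1ℤ) * (+ n - 1ℤ) + x
      sum-nonneg x 1≤n bound = subst (λ K → 0ℤ ≤ K + x) (square-pred 1≤n) (abs-bound x bound)

      difference-nonneg : ∀ {n} x → 1 ≤ⁿ n → ∣ x ∣ ≤ⁿ (n ∸ 1) ℕᵇ.* (n ∸ 1) →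
        0ℤ ≤ (+ n - 1ℤ) * (+ n - 1ℤ) - x
      difference-nonneg {n} x 1≤n bound = sum-nonneg (- x) 1≤n
        (subst (_≤ⁿ (n ∸ 1) ℕᵇ.* (n ∸ 1)) (sym (ℤₚ.∣-i∣≡∣i∣ x)) bound)

    deviation : ℤ → ℤ
    deviation C = (C - + w) * (+ w + (A + B)) - C * (B * σ + A * τ)

    -- Uses `σ ≥ -(a - 1)²`, `τ ≥ -(b - 1)²` and `(c - w)(w + a + b) = c(a + b) + b² - (b² - b w +
    -- w²)`. The remaining polynomial in `a` and `b` is regrouped into products of `a`, `b`, `a -
    -- 1`, `b - 1` and `b - 2`, whence `2 ≤ b`.
    deviation-≤ : deviation (+ c) ≤ upper-deviation A B
    deviation-≤ = subst (λ C → deviation C ≤ upper-deviation A B) (sym c≡a+2b)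
      (≤-from-slack _ (+-nonneg (+-nonneg (+-nonneg
        (*-nonneg 0≤C (*-nonneg 0≤B (sum-nonneg σ 1≤a ∣σ∣≤)))
        (*-nonneg 0≤C (*-nonneg 0≤A (sum-nonneg τ (ℕₚ.<⇒≤ 2≤b) ∣τ∣≤))))
        (quadratic-nonneg b w)) slack-nonneg)
        (identity A B (+ w) σ τ))
      where
      slack-nonneg : 0ℤ ≤ + 2 * (A * B * (A + + 2 * B) * (α * β)) + + 2 * ((A + + 2 * B) * (B * α))
        + + 2 * (A * A * β) + + 2 * (A * B * γ) + B * (+ 2 * (α * β) + γ) + (A + B)
      slack-nonneg = +-nonneg (+-nonneg (+-nonneg (+-nonneg (+-nonneg
        (*-nonneg 0≤2 (*-nonneg (*-nonneg (*-nonneg 0≤A 0≤B) 0≤C) (*-nonneg 0≤α 0≤β)))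
        (*-nonneg 0≤2 (*-nonneg 0≤C (*-nonneg 0≤B 0≤α))))
        (*-nonneg 0≤2 (*-nonneg (*-nonneg 0≤A 0≤A) 0≤β)))
        (*-nonneg 0≤2 (*-nonneg (*-nonneg 0≤A 0≤B) 0≤γ)))
        (*-nonneg 0≤B (+-nonneg (*-nonneg 0≤2 (*-nonneg 0≤α 0≤β)) 0≤γ)))
        (+-nonneg 0≤A 0≤B)
      identity : ∀ A B w σ τ →
        (A + + 2 * B - w) * (w + (A + B)) - (A + + 2 * B) * (B * σ + A * τ)
        + ((A + + 2 * B) * (B * ((A - 1ℤ) * (A - 1ℤ) + σ)) + (A + + 2 * B) * (A * ((B - 1ℤ) * (B - 1ℤ) + τ))
        + (B * B - B * w + w * w)
        + (+ 2 * (A * B * (A + + 2 * B) * ((A - 1ℤ) * (B - 1ℤ))) + + 2 * ((A + + 2 * B) * (B * (A - 1ℤ)))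
        + + 2 * (A * A * (B - 1ℤ)) + + 2 * (A * B * (B - + 2))
        + B * (+ 2 * ((A - 1ℤ) * (B - 1ℤ)) + (B - + 2)) + (A + B)))
        ≡ A * B * (A + + 2 * B) * (+ 2 * (A * B) - (A + B) + + 2) + (A + B) - + 2 * (A * B)
      identity = solve-∀

    -- Uses the opposite bounds on `σ` and `τ`, and `(c - w)(w + a + b) ≥ 0` from `w < c`; the rest
    -- is again a sum of nonnegative products.
    deviation-≥ : lower-deviation A B ≤ deviation (+ c)
    deviation-≥ = subst (λ C → lower-deviation A B ≤ deviation C) (sym c≡a+2b)
      (≤-from-slack _ (+-nonneg (+-nonneg (+-nonneg
        (*-nonneg 0≤C (*-nonneg 0≤B (difference-nonneg σ 1≤a ∣σ∣≤)))
        (*-nonneg 0≤C (*-nonneg 0≤A (difference-nonneg τ (ℕₚ.<⇒≤ 2≤b) ∣τ∣≤))))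
        (*-nonneg 0≤C-w (+-nonneg (pos-nonneg w) (+-nonneg 0≤A 0≤B)))) slack-nonneg)
        (identity A B (+ w) σ τ))
      where
      0≤C-w : 0ℤ ≤ A + + 2 * B - + w
      0≤C-w = subst (λ C → 0ℤ ≤ C - + w) c≡a+2b (ℤₚ.i≤j⇒0≤j-i (ℤᵇ.+≤+ (ℕₚ.<⇒≤ w<c)))
      slack-nonneg : 0ℤ ≤ + 2 * (A * B * (A * B * (α + + 2 * B) + (A * β + α)))
        + (α + + 2 * B) * (A + B) + + 2 * ((A + + 2 * B) * (A * β + B * α))
      slack-nonneg = +-nonneg (+-nonneg
        (*-nonneg 0≤2 (*-nonneg (*-nonneg 0≤A 0≤B) (+-nonneg (*-nonneg (*-nonneg 0≤A 0≤B)
          (+-nonneg 0≤α (*-nonneg 0≤2 0≤B))) (+-nonneg (*-nonneg 0≤A 0≤β) 0≤α))))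
        (*-nonneg (+-nonneg 0≤α (*-nonneg 0≤2 0≤B)) (+-nonneg 0≤A 0≤B)))
        (*-nonneg 0≤2 (*-nonneg 0≤C (+-nonneg (*-nonneg 0≤A 0≤β) (*-nonneg 0≤B 0≤α))))
      identity : ∀ A B w σ τ →
        - (A * B * (A + + 2 * B) * (+ 2 * (A * B) + (A + B))) + (A + B) + + 2 * (A * B)
        + ((A + + 2 * B) * (B * ((A - 1ℤ) * (A - 1ℤ) - σ)) + (A + + 2 * B) * (A * ((B - 1ℤ) * (B - 1ℤ) - τ))
        + (A + + 2 * B - w) * (w + (A + B))
        + (+ 2 * (A * B * (A * B * (A - 1ℤ + + 2 * B) + (A * (B - 1ℤ) + (A - 1ℤ))))
        + (A - 1ℤ + + 2 * B) * (A + B) + + 2 * ((A + + 2 * B) * (A * (B - 1ℤ) + B * (A - 1ℤ)))))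
        ≡ (A + + 2 * B - w) * (w + (A + B)) - (A + + 2 * B) * (B * σ + A * τ)
      identity = solve-∀

  -- From integer to rational inequalities.

  toℚᵘ-/ : ∀ x d .{{_ : NonZero d}} → ℚ.toℚᵘ (x ℚ./ d) ℚᵘ.≃ x ℚᵘ./ d
  toℚᵘ-/ x (suc d) = ℚₚ.toℚᵘ-fromℚᵘ (ℚᵘ.mkℚᵘ x d)

  toℚᵘ-/-+ : ∀ x y d .{{_ : NonZero d}} →
    ℚ.toℚᵘ (x ℚ./ d ℚ.+ y ℚ./ d) ℚᵘ.≃ x ℚᵘ./ d ℚᵘ.+ y ℚᵘ./ d
  toℚᵘ-/-+ x y d = ℚᵘₚ.≃-trans (ℚₚ.toℚᵘ-homo-+ (x ℚ./ d) (y ℚ./ d))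
    (ℚᵘₚ.+-cong (toℚᵘ-/ x d) (toℚᵘ-/ y d))

  private
    common-denominator : ∀ x y d → (x * d + y * d) * 1ℤ ≡ (x + y) * d
    common-denominator = solve-∀

  -- Unnormalised addition yields `(x d + y d) / d²` without cancelling the common denominator, so
  -- `le` is multiplied by `d` once more.
  /-+-≤ : ∀ x y z d .{{_ : NonZero d}} → x + y ≤ z * + d → x ℚ./ d ℚ.+ y ℚ./ d ℚ.≤ z ℚ./ 1
  /-+-≤ x y z d@(suc _) le = ℚₚ.toℚᵘ-cancel-≤ (ℚᵘₚ.≤-respˡ-≃ (ℚᵘₚ.≃-sym (toℚᵘ-/-+ x y d))
    (ℚᵘₚ.≤-respʳ-≃ (ℚᵘₚ.≃-sym (toℚᵘ-/ z 1)) (ℚᵘ.*≤*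
      (subst₂ _≤_ (sym (common-denominator x y (+ d)))
        (trans (ℤₚ.*-assoc z (+ d) (+ d)) (cong (_*_ z) (sym (ℤₚ.pos-* d d))))
        (ℤₚ.*-monoʳ-≤-nonNeg (+ d) le)))))

  ≤-/-+ : ∀ x y z d .{{_ : NonZero d}} → z * + d ≤ x + y → z ℚ./ 1 ℚ.≤ x ℚ./ d ℚ.+ y ℚ./ d
  ≤-/-+ x y z d@(suc _) le = ℚₚ.toℚᵘ-cancel-≤ (ℚᵘₚ.≤-respʳ-≃ (ℚᵘₚ.≃-sym (toℚᵘ-/-+ x y d))
    (ℚᵘₚ.≤-respˡ-≃ (ℚᵘₚ.≃-sym (toℚᵘ-/ z 1)) (ℚᵘ.*≤*
      (subst₂ _≤_ (trans (ℤₚ.*-assoc z (+ d) (+ d)) (cong (_*_ z) (sym (ℤₚ.pos-* d d))))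
        (sym (common-denominator x y (+ d)))
        (ℤₚ.*-monoʳ-≤-nonNeg (+ d) le)))))

  -- Coprimality of the three parts and assembly.

  odd⇒coprime-2 : ∀ {s} → 2 ∤ s → Coprime s 2
  odd⇒coprime-2 2∤s {0} (_ , 0∣2) = contradiction (Div.0∣⇒≡0 0∣2) λ ()
  odd⇒coprime-2 2∤s {1} _ = refl
  odd⇒coprime-2 2∤s {2} (2∣s , _) = contradiction 2∣s 2∤s
  odd⇒coprime-2 2∤s {suc (suc (suc _))} (_ , d∣2) = contradiction (Div.∣⇒≤ d∣2) λ { (s≤s (s≤s ())) }

  integer-bounds : ∀ r s → 1 ≤ⁿ s → Coprime r s → 2 ∤ s → 2 ℕᵇ.* s <ⁿ r →
    ∀ p → p IsReciprocalOf denominator r s → ∀ n →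
    P₂-numerator (+ r) (+ s) (+ n) + C₃ᵈ-numerator (+ r) (+ s) ≤ p n * + (2 ℕᵇ.* Δ₂ r s)
    × p n * + (2 ℕᵇ.* Δ₂ r s) ≤ P₂-numerator (+ r) (+ s) (+ n) + C₃ᵘ-numerator (+ r) (+ s)
  integer-bounds r s 1≤s r⊥s 2∤s 2s<r p recip n =
    subst₂ _≤_ lower-eq value-eq
      (ℤₚ.+-monoʳ-≤ leading (deviation-≥ s b c 1≤s 2≤b c≡ w w<c σ τ ∣σ∣≤ ∣τ∣≤)) ,
    subst₂ _≤_ value-eq upper-eq
      (ℤₚ.+-monoʳ-≤ leading (deviation-≤ s b c 1≤s 2≤b c≡ w w<c σ τ ∣σ∣≤ ∣τ∣≤))
    where
    b c : ℕ
    b = r ∸ s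
    c = 2 ℕᵇ.* r ∸ s

    s≤r : s ≤ⁿ r
    s≤r = ℕₚ.≤-trans (ℕₚ.m≤n*m s 2) (ℕₚ.<⇒≤ 2s<r)
    s+b≡r : s ℕᵇ.+ b ≡ r
    s+b≡r = ℕₚ.m+[n∸m]≡n s≤r
    s<b : s <ⁿ b
    s<b = ℕₚ.+-cancelˡ-< s s b (subst₂ _<ⁿ_ (cong (s ℕᵇ.+_) (ℕₚ.+-identityʳ s)) (sym s+b≡r) 2s<r)
    2≤b : 2 ≤ⁿ b
    2≤b = ℕₚ.≤-trans (s≤s 1≤s) s<b
    s+c≡2r : s ℕᵇ.+ c ≡ 2 ℕᵇ.* r
    s+c≡2r = ℕₚ.m+[n∸m]≡n (ℕₚ.≤-trans s≤r (ℕₚ.m≤n*m r 2))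

    r≡ : + r ≡ + s + + b
    r≡ = cong +_ (sym s+b≡r)
    c≡ℕ : c ≡ s ℕᵇ.+ 2 ℕᵇ.* b
    c≡ℕ = ℕₚ.+-cancelˡ-≡ s c (s ℕᵇ.+ 2 ℕᵇ.* b) (begin
      s ℕᵇ.+ c                       ≡⟨ s+c≡2r ⟩
      2 ℕᵇ.* r                       ≡⟨ cong (2 ℕᵇ.*_) s+b≡r ⟨
      2 ℕᵇ.* (s ℕᵇ.+ b)              ≡⟨ ℕₚ.*-distribˡ-+ 2 s b ⟩
      2 ℕᵇ.* s ℕᵇ.+ 2 ℕᵇ.* b         ≡⟨ cong (λ x → s ℕᵇ.+ x ℕᵇ.+ 2 ℕᵇ.* b) (ℕₚ.+-identityʳ s) ⟩
      s ℕᵇ.+ s ℕᵇ.+ 2 ℕᵇ.* b         ≡⟨ ℕₚ.+-assoc s s (2 ℕᵇ.* b) ⟩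
      s ℕᵇ.+ (s ℕᵇ.+ 2 ℕᵇ.* b)       ∎)
    c≡ : + c ≡ + s + + 2 * + b
    c≡ = trans (cong +_ c≡ℕ) (cong (_+_ (+ s)) (ℤₚ.pos-* 2 b))

    s⊥b : Coprime s b
    s⊥b {d} (d∣s , d∣b) = r⊥s (subst (d Div.∣_) s+b≡r (Div.∣m∣n⇒∣m+n d∣s d∣b) , d∣s)
    -- A common divisor of `s` and `c = s + 2b` divides `2b`; dividing the odd number `s`, it is
    -- coprime to 2 and so divides `b`.
    s⊥c : Coprime s c
    s⊥c {d} (d∣s , d∣c) = s⊥b (d∣s , Coprimality.coprime-divisor d⊥2 d∣2b)
      where
      d⊥2 : Coprime d 2
      d⊥2 (e∣d , e∣2) = odd⇒coprime-2 2∤s (Div.∣-trans e∣d d∣s , e∣2)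
      d∣2b : d Div.∣ 2 ℕᵇ.* b
      d∣2b = Div.∣m+n∣m⇒∣n (subst (d Div.∣_) c≡ℕ d∣c) d∣s
    b⊥c : Coprime b c
    b⊥c {d} (d∣b , d∣c) = s⊥b
      (Div.∣m+n∣m⇒∣n (subst (d Div.∣_) (trans c≡ℕ (ℕₚ.+-comm s (2 ℕᵇ.* b))) d∣c) (Div.∣n⇒∣m*n 2 d∣b) , d∣b)

    instance
      s≢0 : NonZero s
      s≢0 = ℕᵇ.>-nonZero 1≤s
      b≢0 : NonZero b
      b≢0 = ℕᵇ.>-nonZero (ℕₚ.<⇒≤ 2≤b)
      c≢0 : NonZero c
      c≢0 = ℕᵇ.>-nonZero (subst (0 <ⁿ_) (sym c≡ℕ) (ℕₚ.≤-trans 1≤s (ℕₚ.m≤m+n s (2 ℕᵇ.* b))))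

    open Estimate (estimate s b c s⊥b s⊥c b⊥c p recip n)

    leading : ℤ
    leading = + n * + n + + n * (+ s + + b + + c)

    value-eq : leading + deviation s b c 1≤s 2≤b c≡ w w<c σ τ ∣σ∣≤ ∣τ∣≤ (+ c) ≡ p n * + (2 ℕᵇ.* Δ₂ r s)
    value-eq = begin
      leading + ((+ c - + w) * (+ w + (+ s + + b)) - + c * (+ b * σ + + s * τ))
        ≡⟨ formula ⟨
      + 2 * (+ s * + b * + c) * p n
        ≡⟨ ℤₚ.*-comm _ (p n) ⟩
      p n * (+ 2 * (+ s * + b * + c))
        ≡⟨ cong (λ x → p n * (+ 2 * x)) (trans (cong (_* + c) (sym (ℤₚ.pos-* s b))) (sym (ℤₚ.pos-* (s ℕᵇ.* b) c))) ⟩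
      p n * (+ 2 * + Δ₂ r s)
        ≡⟨ cong (_*_ (p n)) (ℤₚ.pos-* 2 (Δ₂ r s)) ⟨
      p n * + (2 ℕᵇ.* Δ₂ r s) ∎

    lower-eq : leading + lower-deviation (+ s) (+ b) ≡
      P₂-numerator (+ r) (+ s) (+ n) + C₃ᵈ-numerator (+ r) (+ s)
    lower-eq = trans
      (cong (λ C → + n * + n + + n * (+ s + + b + C) + lower-deviation (+ s) (+ b)) c≡)
      (trans (sym (lower-numerator (+ s) (+ b) (+ n)))
        (cong (λ R → P₂-numerator R (+ s) (+ n) + C₃ᵈ-numerator R (+ s)) (sym r≡)))
    upper-eq : leading + upper-deviation (+ s) (+ b) ≡
      P₂-numerator (+ r) (+ s) (+ n) + C₃ᵘ-numerator (+ r) (+ s)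
    upper-eq = trans
      (cong (λ C → + n * + n + + n * (+ s + + b + C) + upper-deviation (+ s) (+ b)) c≡)
      (trans (sym (upper-numerator (+ s) (+ b) (+ n)))
        (cong (λ R → P₂-numerator R (+ s) (+ n) + C₃ᵘ-numerator R (+ s)) (sym r≡)))

open import Data.Nat.Base using (_*_)
open import Data.Rational.Base using (_/_; _+_; _≤_)

lemma4p2 : (r s : ℕ) → 1 ≤ⁿ r → (1≤s : 1 ≤ⁿ s) → Coprime r s → 2 ∤ s →
    (2s<r : 2 * s <ⁿ r) →
    (p : Series) → p IsReciprocalOf denominator r s →
    (n : ℕ) →
    let instance
          2Δ₂≢0 : NonZero (2 * Δ₂ r s)
          2Δ₂≢0 = 2Δ₂-nonZero 1≤s 2s<r
    in (P₂ r s n + C₃ᵈ r s ≤ p n / 1) × (p n / 1 ≤ P₂ r s n + C₃ᵘ r s)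
lemma4p2 r s _ 1≤s r⊥s 2∤s 2s<r p recip n =
  -- `P₂`, `C₃ᵈ` and `C₃ᵘ` unfold to these numerators over `2 * Δ₂ r s`, so the integer bounds apply
  -- without rewriting.
  /-+-≤ (P₂-numerator (+ r) (+ s) (+ n)) (C₃ᵈ-numerator (+ r) (+ s)) (p n) (2 * Δ₂ r s)
    (proj₁ bounds) ,
  ≤-/-+ (P₂-numerator (+ r) (+ s) (+ n)) (C₃ᵘ-numerator (+ r) (+ s)) (p n) (2 * Δ₂ r s)
    (proj₂ bounds)
  where
  bounds = integer-bounds r s 1≤s r⊥s 2∤s 2s<r p recip n
  instance
    2Δ₂≢0 : NonZero (2 * Δ₂ r s)
    2Δ₂≢0 = 2Δ₂-nonZero 1≤s 2s<r
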